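{- Let $\Omega$, $F$, the action sets $A(f,\sigma)$, the multi-digraph $D$, the neighborhoods $\Gamma(f)$ and the amenabilities $A_f$ be as in the context, with $D$ atomic. Suppose there exist positive real numbers $\{\mu_f\}_{f\in F}$ such that for every flaw $f \in F$, $$\frac{1}{A_f}\prod_{g \in \Gamma(f)} (1+\mu_g) < \mu_f .$$ Then for any ordering $\pi$ of $F$, any $\sigma_1 \in \Omega$ and any $s\ge 0$, the uniform random walk on $D_{\pi}$ starting from $\sigma_1$ reaches a sink within $(T_0+s)/\delta$ steps with probability at least $1-2^{ -s}$, where $$\delta = 1 - \max_{f \in F} \left(\frac{1}{\mu_f A_f} \prod_{g \in \Gamma(f)} (1+\mu_g)\right) > 0 ,$$ $$T_0 = \log_2 | \Omega | + |U(\sigma_1) |\cdot \log_2 \left(1 + \frac{ \max_{f \in F}(\mu_f A_f)}{ \min_{f \in F} A_f} \right) .$$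
   Context: $\Omega$ is a finite nonempty set whose elements are called states, and $F$ is a finite nonempty collection of nonempty subsets of $\Omega$, called flaws. Flaw $f$ is present in $\sigma\in\Omega$ if $\sigma\in f$; $U(\sigma)=\{f\in F:\sigma\in f\}$; $\sigma$ is flawless if $U(\sigma)=\emptyset$. For each $\sigma\in\Omega$ and $f\in U(\sigma)$ a set of actions $A(f,\sigma)\subseteq\Omega$ containing at least one element other than $\sigma$ is given (possibly also $\sigma\in A(f,\sigma)$). $D$ is the multi-digraph on $\Omega$ having, for each $\sigma\in\Omega$, $f\in U(\sigma)$ and $\tau\in A(f,\sigma)$, an arc $\sigma\xrightarrow{f}\tau$ labeled by $f$. A vertex of $D$ is a sink iff it is flawless. $D$ is atomic if for every flaw $f$ and state $\tau$ there is at most one arc of $D$ incoming to $\tau$ labeled by $f$. Causality: for an arc $\sigma\xrightarrow{f}\tau$ of $D$ and a flaw $g$ present in $\tau$, $f$ causes $g$ (in this arc) if $g=f$ or $\sigma\notin g$. The (potential) causality digraph $C$ is the digraph on $F$ with an arc $f\to g$ iff $D$ contains some arc in which $f$ causes $g$. $\Gamma(f)=\{g\in F: f\to g \text{ exists in } C\}$. Amenability: $A_f=\min_{\sigma\in f}|A(f,\sigma)|$. For an ordering $\pi$ of $F$, $I_\pi(\sigma)$ denotes the greatest element of $U(\sigma)$ according to $\pi$, and $D_\pi\subseteq D$ is obtained by retaining, for each flawed state $\sigma$, only the outgoing arcs labeled $I_\pi(\sigma)$. Thus the uniform random walk on $D_\pi$ moves from a flawed state $\sigma$ to a uniformly random element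 of $A(I_\pi(\sigma),\sigma)$. Empty products equal 1. -}

module Defs where

import Algebra.Definitions.RawMonoid
open import Algebra.Bundles using (CommutativeRing)
open import Algebra.Morphism.Structures using (module MonoidMorphisms)
open import Data.Bool.Base using (if_then_else_)
open import Data.Fin.Base as Fin using (Fin)
open import Data.Fin.Properties using (any?) renaming (_≟_ to _≟ᶠ_)
open import Data.Fin.Subset using (Subset; _∈_; _∉_; ∣_∣; Nonempty; ⁅_⁆)
open import Data.Fin.Subset.Properties
  using (_∈?_; p⊆q⇒∣p∣≤∣q∣; ∣⁅x⁆∣≡1; x∈⁅y⁆⇒x≡y)
open import Data.List.Base as List using (List; []; _∷_; filter; allFin; length)
import Data.List.Extrema
import Data.List.Extrema.Nat as ℕ-Extrema
open import Data.List.Membership.Propositional.Properties using (∈-filter⁻)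
import Data.List.Relation.Unary.All as All
open import Data.List.Relation.Unary.All.Properties using (all-filter; map⁺)
open import Data.Maybe.Base using (Maybe; just; nothing)
open import Data.Nat.Base as ℕ using (ℕ; zero; suc; z≤n; s≤s; s<s; z<s)
import Data.Nat.Properties as ℕₚ
open import Data.Product.Base using (∃; ∃-syntax; _×_; _,_; proj₁; proj₂)
open import Data.Sum.Base using (_⊎_; inj₁; inj₂)
open import Data.Vec.Base as Vec using (Vec; []; _∷_)
open import Data.Vec.Relation.Unary.Any as VecAny using ()
open import Level using (Level; 0ℓ) renaming (suc to lsuc; _⊔_ to _⊔ˡ_)
open import Relation.Binary.Bundles using (TotalOrder)
open import Relation.Binary.Core using (Rel)
open import Relation.Binary.Definitions using (Cotransitive; Decidable)
open import Relation.Binary.Morphism.Structures using (IsOrderHomomorphism)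
open import Relation.Binary.PropositionalEquality.Core
  using (_≡_; _≢_; refl; sym; subst)
open import Relation.Binary.Structures using (IsStrictPartialOrder; IsTotalOrder)
open import Relation.Nullary.Decidable.Core
  using (Dec; yes; no; does; ¬?; _×-dec_; _⊎-dec_)
open import Relation.Nullary.Negation.Core using (¬_; contradiction)

-- The real numbers, given axiomatically: a Cauchy-complete Archimedean
-- ordered field with binary maxima, together with x ↦ 2ˣ and its inverse.
-- Classically, these axioms determine the structure up to isomorphism.  The
-- order is not assumed decidable, so that they also hold of the constructive
-- reals.

record RealNumbers c ℓ₁ ℓ₂ : Set (lsuc (c ⊔ˡ ℓ₁ ⊔ˡ ℓ₂)) where
  infix  4 _<_ _≤_
  infixl 6 _⊔_
  infix  9 2^_

  field
    commutativeRing : CommutativeRing c ℓ₁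

  open CommutativeRing commutativeRing public
    renaming (Carrier to ℝ)
    using ( _≈_; _+_; _*_; -_; _-_; 0#; 1#; +-rawMonoid; *-rawMonoid
          ; +-identityʳ)
  open MonoidMorphisms +-rawMonoid *-rawMonoid using (IsMonoidHomomorphism)
  open Algebra.Definitions.RawMonoid +-rawMonoid public
    using (sum) renaming (_×_ to _·_)

  fromℕ : ℕ → ℝ
  fromℕ n = n · 1#

  field
    _<_                    : Rel ℝ ℓ₂
    <-isStrictPartialOrder : IsStrictPartialOrder _≈_ _<_
    <-cotransitive         : Cotransitive _<_
    <-tight                : ∀ {x y} → ¬ x < y → ¬ y < x → x ≈ y
    0<1                    : 0# < 1#
    +-monoʳ-<              : ∀ z {x y} → x < y → z + x < z + y
    *-positive             : ∀ {x y} → 0# < x → 0# < y → 0# < x * y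
    reciprocal             : ∀ x → 0# < x → ℝ
    reciprocal-positive    : ∀ x (x>0 : 0# < x) → 0# < reciprocal x x>0
    reciprocal-inverse     : ∀ x (x>0 : 0# < x) → x * reciprocal x x>0 ≈ 1#

  _≤_ : Rel ℝ ℓ₂
  x ≤ y = ¬ y < x

  field
    _⊔_         : ℝ → ℝ → ℝ
    x≤x⊔y       : ∀ x y → x ≤ x ⊔ y
    y≤x⊔y       : ∀ x y → y ≤ x ⊔ y
    ⊔-lub       : ∀ {x y z} → x ≤ z → y ≤ z → x ⊔ y ≤ z
    archimedean : ∀ x → ∃[ n ] x < fromℕ n
    complete    : (x : ℕ → ℝ) →
                  (∀ ε → 0# < ε →
                    ∃[ N ] ∀ i j → N ℕ.≤ i → N ℕ.≤ j → x i < x j + ε) →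
                  ∃[ l ] ∀ ε → 0# < ε →
                    ∃[ N ] ∀ i → N ℕ.≤ i → x i < l + ε × l < x i + ε
    2^_         : ℝ → ℝ
    2^-isMonoidHomomorphism : IsMonoidHomomorphism 2^_
    2^-isOrderHomomorphism  : IsOrderHomomorphism _≈_ _≈_ _<_ _<_ 2^_
    2^1≈2       : 2^ 1# ≈ fromℕ 2
    log         : ∀ x → 0# < x → ℝ
    2^log       : ∀ x (x>0 : 0# < x) → 2^ (log x x>0) ≈ x

  open IsStrictPartialOrder <-isStrictPartialOrder public
    using (<-respʳ-≈; <-respˡ-≈) renaming (trans to <-trans; irrefl to <-irrefl)

  <-≤-trans : ∀ {x y z} → x < y → y ≤ z → x < z
  <-≤-trans {z = z} x<y y≤z with <-cotransitive x<y z
  ... | inj₁ x<z = x<z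
  ... | inj₂ z<y = contradiction z<y y≤z

  +-positive : ∀ {x y} → 0# < x → 0# < y → 0# < x + y
  +-positive {x} x>0 y>0 =
    <-trans x>0 (<-respˡ-≈ (+-identityʳ x) (+-monoʳ-< x y>0))

  fromℕ-positive : ∀ {n} → 0 ℕ.< n → 0# < fromℕ n
  fromℕ-positive {suc zero}    _ = <-respʳ-≈ (≈-sym (+-identityʳ 1#)) 0<1
    where open CommutativeRing commutativeRing using () renaming (sym to ≈-sym)
  fromℕ-positive {suc (suc n)} _ = +-positive 0<1 (fromℕ-positive {suc n} z<s)

  ℝ⁺ : Set (c ⊔ˡ ℓ₂)
  ℝ⁺ = ∃[ x ] 0# < x

  value : ℝ⁺ → ℝ
  value = proj₁

  infixl 7 _/_ _*⁺_ _/⁺_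

  _/_ : ℝ → ℝ⁺ → ℝ
  x / (y , y>0) = x * reciprocal y y>0

  log₂ : ℝ⁺ → ℝ
  log₂ (x , x>0) = log x x>0

  fromℕ⁺ : ∀ n → 0 ℕ.< n → ℝ⁺
  fromℕ⁺ n n>0 = fromℕ n , fromℕ-positive n>0

  1+⁺_ : ℝ⁺ → ℝ⁺
  1+⁺ (x , x>0) = 1# + x , +-positive 0<1 x>0

  _*⁺_ _/⁺_ : ℝ⁺ → ℝ⁺ → ℝ⁺
  (x , x>0) *⁺ (y , y>0) = x * y , *-positive x>0 y>0
  (x , x>0) /⁺ (y , y>0) =
    x / (y , y>0) , *-positive x>0 (reciprocal-positive y y>0)

  max : ∀ {m} → (Fin (suc m) → ℝ) → ℝ
  max t = Vec.foldr₁ _⊔_ (Vec.tabulate t)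

  max⁺ : ∀ {m} → (Fin (suc m) → ℝ⁺) → ℝ⁺
  max⁺ t = max (λ i → value (t i)) , positive t
    where
    positive : ∀ {m} (t : Fin (suc m) → ℝ⁺) → 0# < max (λ i → value (t i))
    positive {zero}  t = proj₂ (t Fin.zero)
    positive {suc m} t = <-≤-trans (proj₂ (t Fin.zero)) (x≤x⊔y _ _)

  ∏ : ∀ {a} {A : Set a} → List A → (A → ℝ) → ℝ
  ∏ xs h = List.foldr (λ x p → h x * p) 1# xs

  -- Sum over all vectors of length t.
  ∑Vec : ∀ {n} t → (Vec (Fin n) t → ℝ) → ℝ
  ∑Vec zero    h = h []
  ∑Vec (suc t) h = sum λ i → ∑Vec t λ v → h (i ∷ v)

  -- Being within x steps (x real) means being within ⌊ x ⌋ steps.  As the floor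
  -- of a real is not computable, ⌊ x ⌋ ≤ t is expressed by x < t + 1.
  ⌊_⌋≤_ : ℝ → ℕ → Set ℓ₂
  ⌊ x ⌋≤ t = x < fromℕ (suc t)

∣p∣>0 : ∀ {n} {p : Subset n} {x} → x ∈ p → 0 ℕ.< ∣ p ∣
∣p∣>0 {p = p} {x} x∈p = subst (ℕ._≤ ∣ p ∣) (∣⁅x⁆∣≡1 x)
  (p⊆q⇒∣p∣≤∣q∣ λ y∈⁅x⁆ → subst (_∈ p) (sym (x∈⁅y⁆⇒x≡y _ y∈⁅x⁆)) x∈p)

record FlawSystem (n m : ℕ) : Set where
  Ω : Set
  Ω = Fin (suc n)

  F : Set
  F = Fin (suc m)

  field
    -- A family indexed by F; repetitions are not excluded.
    states          : F → Subset (suc n)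
    states-nonempty : ∀ f → Nonempty (states f)
    -- Only the values A f σ with f present in σ are meaningful.
    A               : F → Ω → Subset (suc n)
    A-nontrivial    : ∀ f σ → σ ∈ states f → ∃[ τ ] τ ∈ A f σ × τ ≢ σ

  ∣Ω∣ : ℕ
  ∣Ω∣ = suc n

  Present : F → Ω → Set
  Present f σ = σ ∈ states f

  present? : Decidable Present
  present? f σ = σ ∈? states f

  U : Ω → List F
  U σ = filter (λ f → present? f σ) (allFin (suc m))

  -- An arc σ → τ of D labelled f.
  Arc : Ω → F → Ω → Set
  Arc σ f τ = Present f σ × τ ∈ A f σ

  arc? : ∀ σ f τ → Dec (Arc σ f τ)
  arc? σ f τ = present? f σ ×-dec τ ∈? A f σ

  Atomic : Set
  Atomic = ∀ f τ {σ σ′} → Arc σ f τ → Arc σ′ f τ → σ ≡ σ′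

  Sink : Ω → Set
  Sink σ = ¬ (∃[ f ] ∃[ τ ] Arc σ f τ)

  sink? : ∀ σ → Dec (Sink σ)
  sink? σ = ¬? (any? λ f → any? λ τ → arc? σ f τ)

  -- f causes g in some arc of D.
  _⟶_ : F → F → Set
  f ⟶ g = ∃[ σ ] ∃[ τ ] Arc σ f τ × Present g τ × (g ≡ f ⊎ ¬ Present g σ)

  _⟶?_ : Decidable _⟶_
  f ⟶? g = any? λ σ → any? λ τ →
    arc? σ f τ ×-dec (present? g τ ×-dec (g ≟ᶠ f ⊎-dec ¬? (present? g σ)))

  Γ : F → List F
  Γ f = filter (f ⟶?_) (allFin (suc m))

  -- The minimum of ∣ A f σ ∣ over all σ in which f is present; the first
  -- argument of min makes a minimum over a list total, and here is itself one
  -- of the values.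
  amenability : F → ℕ
  amenability f = ℕ-Extrema.min ∣ A f (proj₁ (states-nonempty f)) ∣
    (List.map (λ σ → ∣ A f σ ∣) (filter (present? f) (allFin (suc n))))

  A>0 : ∀ {f σ} → Present f σ → 0 ℕ.< ∣ A f σ ∣
  A>0 {f} {σ} σ∈f = ∣p∣>0 (proj₁ (proj₂ (A-nontrivial f σ σ∈f)))

  amenability>0 : ∀ f → 0 ℕ.< amenability f
  amenability>0 f = ℕ-Extrema.v<min⁺ (A>0 (proj₂ (states-nonempty f)))
    (map⁺ (All.map A>0 (all-filter (present? f) (allFin (suc n)))))

  minAmenability : ℕ
  minAmenability = Vec.foldr₁ ℕ._⊓_ (Vec.tabulate amenability)

  minAmenability>0 : 0 ℕ.< minAmenability
  minAmenability>0 = positive amenability amenability>0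
    where
    positive : ∀ {k} (t : Fin (suc k) → ℕ) → (∀ i → 0 ℕ.< t i) →
               0 ℕ.< Vec.foldr₁ ℕ._⊓_ (Vec.tabulate t)
    positive {zero}  t t>0 = t>0 Fin.zero
    positive {suc k} t t>0 = ℕₚ.⊓-glb (t>0 Fin.zero)
      (positive (λ i → t (Fin.suc i)) (λ i → t>0 (Fin.suc i)))

  module Priority {_≼_ : Rel F 0ℓ} (π : IsTotalOrder _≡_ _≼_) where

    totalOrder : TotalOrder 0ℓ 0ℓ 0ℓ
    totalOrder = record { isTotalOrder = π }

    open Data.List.Extrema totalOrder
      using () renaming (max to greatest)

    -- nothing exactly in the flawless states.
    I : Ω → Maybe F
    I σ with U σ
    ... | []     = nothing
    ... | f ∷ fs = just (greatest f fs)

module Walk {c ℓ₁ ℓ₂} (R : RealNumbers c ℓ₁ ℓ₂) {n m} (S : FlawSystem n m)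
            {_≼_ : Rel (FlawSystem.F S) 0ℓ} (π : IsTotalOrder _≡_ _≼_) where

  open RealNumbers R
  open FlawSystem S
  open Priority π

  uniform : Subset ∣Ω∣ → Ω → ℝ
  uniform B τ with τ ∈? B
  ... | yes τ∈B = 1# / fromℕ⁺ ∣ B ∣ (∣p∣>0 τ∈B)
  ... | no  _   = 0#

  -- Transition probabilities of the uniform random walk on D_π, which is
  -- taken to stay put once it has reached a sink.
  transition : Ω → Ω → ℝ
  transition σ with I σ
  ... | just f  = uniform (A f σ)
  ... | nothing = uniform ⁅ σ ⁆

  -- Probability that the walk from σ begins with the given further states.
  trajectoryProbability : ∀ {t} → Ω → Vec Ω t → ℝ
  trajectoryProbability σ []      = 1#
  trajectoryProbability σ (τ ∷ v) = transition σ τ * trajectoryProbability τ v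

  ℙ[reaches-sink-from_within_steps] : Ω → ℕ → ℝ
  ℙ[reaches-sink-from σ within t steps] = ∑Vec t λ v →
    if does (VecAny.any? sink? (σ ∷ v)) then trajectoryProbability σ v else 0#

module Parameters {c ℓ₁ ℓ₂} (R : RealNumbers c ℓ₁ ℓ₂) {n m}
                  (S : FlawSystem n m)
                  (μ : FlawSystem.F S → RealNumbers.ℝ⁺ R) where

  open RealNumbers R
  open FlawSystem S

  A⁺ : F → ℝ⁺
  A⁺ f = fromℕ⁺ (amenability f) (amenability>0 f)

  ∏Γ : F → ℝ
  ∏Γ f = ∏ (Γ f) λ g → 1# + value (μ g)

  Condition : Set ℓ₂
  Condition = ∀ f → 1# / A⁺ f * ∏Γ f < value (μ f)

  δ : ℝ
  δ = 1# - max λ f → 1# / (μ f *⁺ A⁺ f) * ∏Γ f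

  T₀ : Ω → ℝ
  T₀ σ = log₂ (fromℕ⁺ ∣Ω∣ z<s)
       + fromℕ (length (U σ)) *
         log₂ (1+⁺ (max⁺ (λ f → μ f *⁺ A⁺ f)
                    /⁺ fromℕ⁺ minAmenability minAmenability>0))

{-# OPTIONS --safe #-}
module Submission where

-- For a walk that misses the sinks during T moves, call a flaw pending if it
-- stays present until one of the remaining moves addresses it.  The greatest
-- pending flaw w is the one addressed next, and the pending flaws afterwards are
-- the other ones together with some subset of Γ(w).  As the system is atomic,
-- each state has at most one predecessor along w, so going back one move
-- multiplies the bound r^T ∏_{g ∈ E} μ_g on the probability (summed over all
-- starting states and divided by ∣Ω∣) that E is the set of pending flaws by at
-- most r = 1 - δ: this is the hypothesis, since ∏_{g ∈ Γ(w)} (1 + μ_g) is the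
-- sum of ∏_{g ∈ B} μ_g over all B ⊆ Γ(w).  Summing over all E ⊆ U(σ₁) bounds the
-- probability of missing the sinks by ∣Ω∣ (1 - δ)^T ∏_{g ∈ U(σ₁)} (1 + μ_g),
-- which is at most 2^(T₀ - δT) because 1 - δ ≤ 2^(-δ).

open import Algebra.Morphism.Structures using (module MonoidMorphisms)
import Algebra.Properties.CommutativeMonoid.Sum
import Algebra.Properties.CommutativeSemigroup
import Algebra.Properties.CommutativeSemiring.Exp
import Algebra.Properties.Monoid.Mult
import Algebra.Properties.Ring
import Algebra.Properties.Semiring.Mult
import Algebra.Properties.Semiring.Sum
import Algebra.Solver.CommutativeMonoid
open import Algebra.Bundles using (CommutativeRing)
open import Data.Bool.Base using (Bool; true; false; if_then_else_)
open import Data.Fin.Base using (Fin; zero; suc)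
import Data.Fin.Properties as Finₚ
open import Data.Fin.Subset using (Subset; _∈_; ∣_∣; ⁅_⁆; inside; outside)
open import Data.Fin.Subset.Properties using (_∈?_; x∈⁅x⁆)
open import Data.List.Base as List using (List; []; _∷_; filter; allFin)
import Data.List.Extrema
import Data.List.Extrema.Nat
open import Data.List.Membership.Propositional using () renaming (_∈_ to _∈ˡ_)
open import Data.List.Membership.Propositional.Properties
  using (∈-filter⁺; ∈-map⁺; ∈-allFin)
import Data.List.Relation.Unary.All as All
open import Data.List.Relation.Unary.All.Properties using (all-filter)
open import Data.Maybe.Base using (just; nothing; maybe′)
open import Data.Nat.Base as ℕ using (ℕ; zero; suc; z≤n; s≤s)
import Data.Nat.Properties as ℕₚ
import Data.Nat.Solver
open import Data.Product.Base using (Σ-syntax; ∃-syntax; _×_; _,_; proj₁; proj₂)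
open import Data.Sum.Base using (_⊎_; inj₁; inj₂; [_,_]′)
open import Data.Vec.Base as Vec using (Vec; []; _∷_; lookup)
import Data.Vec.Relation.Unary.Any as VecAny
open import Function.Base using (_∘_; id)
open import Level using (Level; 0ℓ)
open import Relation.Binary.Core using (Rel)
open import Relation.Binary.Morphism.Structures using (IsOrderHomomorphism)
open import Relation.Binary.PropositionalEquality.Core as ≡ using (_≡_)
import Relation.Binary.Reasoning.Base.Triple
import Relation.Binary.Reasoning.Setoid
open import Relation.Binary.Structures using (IsPreorder; IsTotalOrder)
open import Relation.Nullary.Decidable using (dec-true; dec-false)
open import Relation.Nullary.Decidable.Core using (Dec; yes; no; does)
open import Relation.Nullary.Negation.Core using (¬_; contradiction)
open import Relation.Unary using (Decidable)
open import Defs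

-- Atomicity counts predecessors, not successors, so the estimate has to run backward in time and to
-- treat all starts at once. It also needs a label before the predecessor is known; this is why
-- pending flaws are defined through the future: the pending set alone names the flaw addressed
-- next. Given a move, the set before it is a function of the set after it, so the events partition
-- the trajectories; in the other direction there is only a bound, supplied by causality. All
-- indicators are products with one factor per flaw, which reduces identities and bounds about sets
-- to checks on two bits. A separate obstacle is that `2^_` is known only as a strictly monotone
-- homomorphism with value 2 at 1. Its comparison with a linear function is therefore brought back
-- to powers of natural numbers by means of a fraction, and as the order is not decidable, that
-- fraction cannot be found by rounding.

-- Arithmetic of an ordered field with undecidable order.

module RealProperties {c ℓ₁ ℓ₂} (R : RealNumbers c ℓ₁ ℓ₂) where

  open RealNumbers R public
  open CommutativeRing commutativeRing public
    hiding ( Carrier; _≈_; _+_; _*_; -_; _-_; 0#; 1#; +-rawMonoid; *-rawMonoid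
           ; +-identityʳ; zero)
  open Algebra.Properties.Ring ring public using (-‿distribʳ-*)
  open Algebra.Properties.CommutativeSemigroup *-commutativeSemigroup public
    using (x∙yz≈y∙xz; xy∙z≈xz∙y)
  open Algebra.Properties.CommutativeSemiring.Exp commutativeSemiring public
    using (_^_; ^-congˡ; ^-distrib-*)
  open Algebra.Properties.Semiring.Sum semiring public
    using ( sum-cong-≋; sum-replicate-zero; ∑-comm; ∑-distrib-+
          ; *-distribˡ-sum; *-distribʳ-sum)
  open Algebra.Properties.CommutativeMonoid.Sum *-commutativeMonoid public
    using ()
    renaming (sum to product; sum-cong-≋ to product-cong; ∑-distrib-+ to product-distrib-*)

  <⇒≤ : ∀ {x y} → x < y → x ≤ y
  <⇒≤ x<y y<x = <-irrefl refl (<-trans x<y y<x)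

  ≤-trans : ∀ {x y z} → x ≤ y → y ≤ z → x ≤ z
  ≤-trans {y = y} x≤y y≤z z<x = [ y≤z , x≤y ]′ (<-cotransitive z<x y)

  ≤-isPreorder : IsPreorder _≈_ _≤_
  ≤-isPreorder = record
    { isEquivalence = isEquivalence
    ; reflexive     = λ x≈y → <-irrefl (sym x≈y)
    ; trans         = ≤-trans
    }

  open IsPreorder ≤-isPreorder public
    using () renaming (refl to ≤-refl; reflexive to ≤-reflexive)

  ≤-<-trans : ∀ {x y z} → x ≤ y → y < z → x < z
  ≤-<-trans {x} x≤y y<z = [ (λ y<x → contradiction y<x x≤y) , id ]′ (<-cotransitive y<z x)

  module ≤-Reasoning = Relation.Binary.Reasoning.Base.Triple
    ≤-isPreorder (λ x<y y<x → <-irrefl refl (<-trans x<y y<x)) <-trans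
    (<-respʳ-≈ , <-respˡ-≈) <⇒≤ <-≤-trans ≤-<-trans

  module ≈-Reasoning = Relation.Binary.Reasoning.Setoid setoid

  x+[y-x]≈y : ∀ x y → x + (y - x) ≈ y
  x+[y-x]≈y x y = begin
    x + (y - x)  ≈⟨ +-congˡ (+-comm y (- x)) ⟩
    x + (- x + y) ≈⟨ +-assoc x (- x) y ⟨
    x - x + y    ≈⟨ +-congʳ (-‿inverseʳ x) ⟩
    0# + y       ≈⟨ +-identityˡ y ⟩
    y            ∎
    where open ≈-Reasoning

  [x+y]-x≈y : ∀ x y → (x + y) - x ≈ y
  [x+y]-x≈y x y = trans (+-assoc x y (- x)) (x+[y-x]≈y x y)

  +-monoˡ-< : ∀ z {x y} → x < y → x + z < y + z
  +-monoˡ-< z x<y = <-respʳ-≈ (+-comm z _) (<-respˡ-≈ (+-comm z _) (+-monoʳ-< z x<y))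

  +-cancelˡ-< : ∀ z {x y} → z + x < z + y → x < y
  +-cancelˡ-< z {x} {y} lt =
    <-respʳ-≈ ([x+y]-x≈y z y) (<-respˡ-≈ ([x+y]-x≈y z x) (+-monoˡ-< (- z) lt))

  +-monoʳ-≤ : ∀ z {x y} → x ≤ y → z + x ≤ z + y
  +-monoʳ-≤ z x≤y = x≤y ∘ +-cancelˡ-< z

  +-monoˡ-≤ : ∀ z {x y} → x ≤ y → x + z ≤ y + z
  +-monoˡ-≤ z {x} {y} x≤y = begin
    x + z ≈⟨ +-comm x z ⟩
    z + x ≤⟨ +-monoʳ-≤ z x≤y ⟩
    z + y ≈⟨ +-comm z y ⟩
    y + z ∎
    where open ≤-Reasoning

  +-mono-≤ : ∀ {w x y z} → w ≤ x → y ≤ z → w + y ≤ x + z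
  +-mono-≤ w≤x y≤z = ≤-trans (+-monoˡ-≤ _ w≤x) (+-monoʳ-≤ _ y≤z)

  x<y⇒0<y-x : ∀ {x y} → x < y → 0# < y - x
  x<y⇒0<y-x {x} x<y = <-respˡ-≈ (-‿inverseʳ x) (+-monoˡ-< (- x) x<y)

  x≤y⇒0≤y-x : ∀ {x y} → x ≤ y → 0# ≤ y - x
  x≤y⇒0≤y-x {x} {y} x≤y = begin
    0#    ≈⟨ -‿inverseʳ x ⟨
    x - x ≤⟨ +-monoˡ-≤ (- x) x≤y ⟩
    y - x ∎
    where open ≤-Reasoning

  0≤1 : 0# ≤ 1#
  0≤1 = <⇒≤ 0<1

  -- A negative product would rule out both 0 < x and 0 < y, making a factor zero.
  *-nonNegative : ∀ {x y} → 0# ≤ x → 0# ≤ y → 0# ≤ x * y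
  *-nonNegative {x} {y} 0≤x 0≤y xy<0 = 0≮x λ 0<x →
    0≮y λ 0<y → <-irrefl refl (<-trans xy<0 (*-positive 0<x 0<y))
    where
    0≮y : ¬ ¬ 0# < y
    0≮y 0≮y = <-irrefl (trans (*-congˡ (sym (<-tight 0≮y 0≤y))) (zeroʳ x)) xy<0
    0≮x : ¬ ¬ 0# < x
    0≮x 0≮x = <-irrefl (trans (*-congʳ (sym (<-tight 0≮x 0≤x))) (zeroˡ y)) xy<0

  x*[y-z]≈x*y-x*z : ∀ x y z → x * (y - z) ≈ x * y - x * z
  x*[y-z]≈x*y-x*z x y z =
    trans (distribˡ x y (- z)) (+-congˡ (sym (-‿distribʳ-* x z)))

  *-monoʳ-< : ∀ {z x y} → 0# < z → x < y → z * x < z * y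
  *-monoʳ-< {z} {x} {y} 0<z x<y = <-respˡ-≈ (+-identityʳ _) (<-respʳ-≈ eq
    (+-monoʳ-< (z * x) (*-positive 0<z (x<y⇒0<y-x x<y))))
    where
    eq : z * x + z * (y - x) ≈ z * y
    eq = trans (+-congˡ (x*[y-z]≈x*y-x*z z y x)) (x+[y-x]≈y _ _)

  *-monoʳ-≤ : ∀ {z x y} → 0# ≤ z → x ≤ y → z * x ≤ z * y
  *-monoʳ-≤ {z} {x} {y} 0≤z x≤y = begin
    z * x               ≈⟨ +-identityʳ _ ⟨
    z * x + 0#          ≤⟨ +-monoʳ-≤ _ (*-nonNegative 0≤z (x≤y⇒0≤y-x x≤y)) ⟩
    z * x + z * (y - x) ≈⟨ +-congˡ (x*[y-z]≈x*y-x*z z y x) ⟩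
    z * x + (z * y - z * x) ≈⟨ x+[y-x]≈y _ _ ⟩
    z * y               ∎
    where open ≤-Reasoning

  *-monoˡ-< : ∀ {z x y} → 0# < z → x < y → x * z < y * z
  *-monoˡ-< 0<z x<y = <-respʳ-≈ (*-comm _ _) (<-respˡ-≈ (*-comm _ _) (*-monoʳ-< 0<z x<y))

  *-monoˡ-≤ : ∀ {z x y} → 0# ≤ z → x ≤ y → x * z ≤ y * z
  *-monoˡ-≤ {z} {x} {y} 0≤z x≤y = begin
    x * z ≈⟨ *-comm x z ⟩
    z * x ≤⟨ *-monoʳ-≤ 0≤z x≤y ⟩
    z * y ≈⟨ *-comm z y ⟩
    y * z ∎
    where open ≤-Reasoning

  *-mono-≤ : ∀ {w x y z} → 0# ≤ w → 0# ≤ y → w ≤ x → y ≤ z → w * y ≤ x * z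
  *-mono-≤ 0≤w 0≤y w≤x y≤z =
    ≤-trans (*-monoˡ-≤ 0≤y w≤x) (*-monoʳ-≤ (≤-trans 0≤w w≤x) y≤z)

  fromℕ-homo-+ : ∀ m n → fromℕ (m ℕ.+ n) ≈ fromℕ m + fromℕ n
  fromℕ-homo-+ = Algebra.Properties.Monoid.Mult.×-homo-+ +-monoid 1#

  fromℕ-homo-* : ∀ m n → fromℕ (m ℕ.* n) ≈ fromℕ m * fromℕ n
  fromℕ-homo-* = Algebra.Properties.Semiring.Mult.×1-homo-* semiring

  fromℕ-homo-^ : ∀ m n → fromℕ (m ℕ.^ n) ≈ fromℕ m ^ n
  fromℕ-homo-^ m zero    = +-identityʳ 1#
  fromℕ-homo-^ m (suc n) = trans (fromℕ-homo-* m (m ℕ.^ n)) (*-congˡ (fromℕ-homo-^ m n))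

  fromℕ-nonNegative : ∀ n → 0# ≤ fromℕ n
  fromℕ-nonNegative zero    = ≤-refl
  fromℕ-nonNegative (suc n) = <⇒≤ (fromℕ-positive {suc n} (s≤s z≤n))

  fromℕ-mono-≤ : ∀ {m n} → m ℕ.≤ n → fromℕ m ≤ fromℕ n
  fromℕ-mono-≤ {n = n} z≤n = fromℕ-nonNegative n
  fromℕ-mono-≤ (s≤s m≤n)   = +-monoʳ-≤ 1# (fromℕ-mono-≤ m≤n)

  ^-nonNegative : ∀ {x} n → 0# ≤ x → 0# ≤ x ^ n
  ^-nonNegative zero    0≤x = 0≤1
  ^-nonNegative (suc n) 0≤x = *-nonNegative 0≤x (^-nonNegative n 0≤x)

  ^-positive : ∀ {x} n → 0# < x → 0# < x ^ n
  ^-positive zero    0<x = 0<1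
  ^-positive (suc n) 0<x = *-positive 0<x (^-positive n 0<x)

  ^-mono-≤ : ∀ {x y} n → 0# ≤ x → x ≤ y → x ^ n ≤ y ^ n
  ^-mono-≤ zero    0≤x x≤y = ≤-refl
  ^-mono-≤ (suc n) 0≤x x≤y = *-mono-≤ 0≤x (^-nonNegative n 0≤x) x≤y (^-mono-≤ n 0≤x x≤y)

  reciprocal-antitone : ∀ (x y : ℝ⁺) → value x ≤ value y → 1# / y ≤ 1# / x
  reciprocal-antitone X@(x , x>0) Y@(y , y>0) x≤y = begin
    1# * y⁻¹         ≈⟨ *-congʳ (reciprocal-inverse x x>0) ⟨
    (x * x⁻¹) * y⁻¹  ≈⟨ *-assoc _ _ _ ⟩
    x * (x⁻¹ * y⁻¹)
      ≤⟨ *-monoˡ-≤ (<⇒≤ (*-positive (reciprocal-positive x x>0) (reciprocal-positive y y>0))) x≤y ⟩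
    y * (x⁻¹ * y⁻¹)  ≈⟨ *-congˡ (*-comm _ _) ⟩
    y * (y⁻¹ * x⁻¹)  ≈⟨ *-assoc _ _ _ ⟨
    (y * y⁻¹) * x⁻¹  ≈⟨ *-congʳ (reciprocal-inverse y y>0) ⟩
    1# * x⁻¹ ∎
    where
    open ≤-Reasoning
    x⁻¹ = reciprocal x x>0
    y⁻¹ = reciprocal y y>0

  x/y*y≈x : ∀ x (y : ℝ⁺) → (x / y) * value y ≈ x
  x/y*y≈x x (y , y>0) = begin
    (x * reciprocal y y>0) * y ≈⟨ *-assoc _ _ _ ⟩
    x * (reciprocal y y>0 * y) ≈⟨ *-congˡ (*-comm _ _) ⟩
    x * (y * reciprocal y y>0) ≈⟨ *-congˡ (reciprocal-inverse y y>0) ⟩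
    x * 1#                     ≈⟨ *-identityʳ x ⟩
    x ∎
    where open ≈-Reasoning

  0</ : ∀ {x} (y : ℝ⁺) → 0# < x → 0# < x / y
  0</ (y , y>0) 0<x = *-positive 0<x (reciprocal-positive y y>0)

  -- The axiom `⊔-lub` only speaks of `≤`. Placing `x ⊔ y` by cotransitivity in `x < z` and in
  -- `y < z` gives the claim unless the maximum exceeds both arguments, which is absurd.
  ⊔-lub-< : ∀ {x y z} → x < z → y < z → x ⊔ y < z
  ⊔-lub-< {x} {y} {z} x<z y<z with <-cotransitive x<z (x ⊔ y) | <-cotransitive y<z (x ⊔ y)
  ... | inj₂ u<z | _        = u<z
  ... | inj₁ _   | inj₂ u<z = u<z
  ... | inj₁ x<u | inj₁ y<u = contradiction y<u (⊔-lub x≤y ≤-refl)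
    where
    x≤y : x ≤ y
    x≤y y<x = ⊔-lub ≤-refl (<⇒≤ y<x) x<u

  max-lub-< : ∀ {m} (t : Fin (suc m) → ℝ) {x} → (∀ i → t i < x) → max t < x
  max-lub-< {zero}  t t<x = t<x zero
  max-lub-< {suc m} t t<x = ⊔-lub-< (t<x zero) (max-lub-< (t ∘ suc) (t<x ∘ suc))

  t≤max : ∀ {m} (t : Fin (suc m) → ℝ) i → t i ≤ max t
  t≤max {zero}  t zero    = ≤-refl
  t≤max {suc m} t zero    = x≤x⊔y _ _
  t≤max {suc m} t (suc i) = ≤-trans (t≤max (t ∘ suc) i) (y≤x⊔y _ _)

-- Inequalities between powers of natural numbers.

-- Bernoulli's inequality (1 + 1/j)ⁱ ≥ 1 + i/j, cleared of denominators.
bernoulli : ∀ j i → j ℕ.^ i ℕ.* (j ℕ.+ i) ℕ.≤ suc j ℕ.^ i ℕ.* j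
bernoulli j zero    = ℕₚ.≤-reflexive (≡.cong (1 ℕ.*_) (ℕₚ.+-identityʳ j))
bernoulli j (suc i) = begin
  j ℕ.* p ℕ.* (j ℕ.+ suc i)
    ≡⟨ solve 3 (λ j p i → j :* p :* (j :+ (con 1 :+ i)) := p :* (j :+ j :* (j :+ i))) ≡.refl j p i ⟩
  p ℕ.* (j ℕ.+ j ℕ.* (j ℕ.+ i))     ≤⟨ ℕₚ.*-monoʳ-≤ p (ℕₚ.+-monoˡ-≤ _ (ℕₚ.m≤m+n j i)) ⟩
  p ℕ.* (suc j ℕ.* (j ℕ.+ i))
    ≡⟨ solve 3 (λ j p q → p :* (j :* q) := j :* (p :* q)) ≡.refl (suc j) p (j ℕ.+ i) ⟩
  suc j ℕ.* (p ℕ.* (j ℕ.+ i))       ≤⟨ ℕₚ.*-monoʳ-≤ (suc j) (bernoulli j i) ⟩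
  suc j ℕ.* (suc j ℕ.^ i ℕ.* j)     ≡⟨ ℕₚ.*-assoc (suc j) (suc j ℕ.^ i) j ⟨
  suc j ℕ.* suc j ℕ.^ i ℕ.* j       ∎
  where
  open ℕₚ.≤-Reasoning
  open Data.Nat.Solver.+-*-Solver
  p = j ℕ.^ i

-- For positive `j`, Bernoulli gives (1 + 1/j)ⁿ ≥ 1 + n/j ≥ 2. For `j = 0` the left side vanishes
-- because `n` is positive.
2*j^n≤[1+j]^n : ∀ j {n} → j ℕ.< n → 2 ℕ.* j ℕ.^ n ℕ.≤ suc j ℕ.^ n
2*j^n≤[1+j]^n zero    {suc n} _   = z≤n
2*j^n≤[1+j]^n (suc j) {n}     j<n = ℕₚ.*-cancelʳ-≤ _ _ (suc j) (begin
  2 ℕ.* p ℕ.* suc j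
    ≡⟨ solve 2 (λ p j → con 2 :* p :* j := p :* (j :+ j)) ≡.refl p (suc j) ⟩
  p ℕ.* (suc j ℕ.+ suc j)      ≤⟨ ℕₚ.*-monoʳ-≤ p (ℕₚ.+-monoʳ-≤ (suc j) (ℕₚ.<⇒≤ j<n)) ⟩
  p ℕ.* (suc j ℕ.+ n)          ≤⟨ bernoulli (suc j) n ⟩
  suc (suc j) ℕ.^ n ℕ.* suc j  ∎)
  where
  open ℕₚ.≤-Reasoning
  open Data.Nat.Solver.+-*-Solver
  p = suc j ℕ.^ n

-- Raising the base by one at least doubles its `n`-th power as long as the base is below `n`; this
-- is done `k` times. For `k + j = n` the result is (1 - k/n)ⁿ ≤ 2⁻ᵏ without denominators.
2^k*j^n≤[k+j]^n : ∀ k j {n} → k ℕ.+ j ℕ.≤ n → 2 ℕ.^ k ℕ.* j ℕ.^ n ℕ.≤ (k ℕ.+ j) ℕ.^ n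
2^k*j^n≤[k+j]^n zero    j _   = ℕₚ.≤-reflexive (ℕₚ.*-identityˡ _)
2^k*j^n≤[k+j]^n (suc k) j {n} k+j<n = begin
  2 ℕ.* 2 ℕ.^ k ℕ.* j ℕ.^ n
    ≡⟨ solve 2 (λ p q → con 2 :* p :* q := p :* (con 2 :* q)) ≡.refl (2 ℕ.^ k) (j ℕ.^ n) ⟩
  2 ℕ.^ k ℕ.* (2 ℕ.* j ℕ.^ n)
    ≤⟨ ℕₚ.*-monoʳ-≤ (2 ℕ.^ k) (2*j^n≤[1+j]^n j (ℕₚ.≤-<-trans (ℕₚ.m≤n+m j k) k+j<n)) ⟩
  2 ℕ.^ k ℕ.* suc j ℕ.^ n
    ≤⟨ 2^k*j^n≤[k+j]^n k (suc j) (ℕₚ.≤-trans (ℕₚ.≤-reflexive (ℕₚ.+-suc k j)) k+j<n) ⟩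
  (k ℕ.+ suc j) ℕ.^ n          ≡⟨ ≡.cong (ℕ._^ n) (ℕₚ.+-suc k j) ⟩
  suc (k ℕ.+ j) ℕ.^ n          ∎
  where
  open ℕₚ.≤-Reasoning
  open Data.Nat.Solver.+-*-Solver

-- The exponential with base 2.

module Exponential {c ℓ₁ ℓ₂} (R : RealNumbers c ℓ₁ ℓ₂) where

  open RealProperties R
  open MonoidMorphisms.IsMonoidHomomorphism 2^-isMonoidHomomorphism public
    using () renaming (homo to 2^-homo-+; ε-homo to 2^0≈1)
  open IsOrderHomomorphism 2^-isOrderHomomorphism public
    using () renaming (cong to 2^-cong; mono to 2^-mono-<)

  2^-homo-fromℕ* : ∀ n x → 2^ (fromℕ n * x) ≈ (2^ x) ^ n
  2^-homo-fromℕ* zero    x = trans (2^-cong (zeroˡ x)) 2^0≈1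
  2^-homo-fromℕ* (suc n) x = begin
    2^ ((1# + fromℕ n) * x)
      ≈⟨ 2^-cong (trans (distribʳ x 1# (fromℕ n)) (+-congʳ (*-identityˡ x))) ⟩
    2^ (x + fromℕ n * x)        ≈⟨ 2^-homo-+ x (fromℕ n * x) ⟩
    2^ x * 2^ (fromℕ n * x)     ≈⟨ *-congˡ (2^-homo-fromℕ* n x) ⟩
    2^ x * (2^ x) ^ n           ∎
    where open ≈-Reasoning

  2^-fromℕ : ∀ n → 2^ (fromℕ n) ≈ fromℕ 2 ^ n
  2^-fromℕ n = begin
    2^ (fromℕ n)      ≈⟨ 2^-cong (*-identityʳ (fromℕ n)) ⟨
    2^ (fromℕ n * 1#) ≈⟨ 2^-homo-fromℕ* n 1# ⟩
    (2^ 1#) ^ n       ≈⟨ ^-congˡ n 2^1≈2 ⟩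
    fromℕ 2 ^ n       ∎
    where open ≈-Reasoning

  2^x*2^-x≈1 : ∀ x → 2^ x * 2^ (- x) ≈ 1#
  2^x*2^-x≈1 x = trans (sym (2^-homo-+ x (- x))) (trans (2^-cong (-‿inverseʳ x)) 2^0≈1)

  -- By monotonicity a positive value somewhere to the left of `x` is enough. The Archimedean axiom
  -- provides a negative integer there, and at that integer the value is the reciprocal of a power
  -- of 2.
  2^-positive : ∀ x → 0# < 2^ x
  2^-positive x = <-trans (<-respʳ-≈ N⁻¹≈2^-n (reciprocal-positive N N>0)) (2^-mono-< -n<x)
    where
    n = proj₁ (archimedean (- x))
    N = fromℕ 2 ^ n
    N>0 : 0# < N
    N>0 = ^-positive n (fromℕ-positive {2} (s≤s z≤n))
    N⁻¹ = reciprocal N N>0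
    N⁻¹≈2^-n : N⁻¹ ≈ 2^ (- fromℕ n)
    N⁻¹≈2^-n = begin
      N⁻¹                            ≈⟨ *-identityʳ N⁻¹ ⟨
      N⁻¹ * 1#                       ≈⟨ *-congˡ (2^x*2^-x≈1 (fromℕ n)) ⟨
      N⁻¹ * (2^ (fromℕ n) * 2^ (- fromℕ n)) ≈⟨ *-assoc _ _ _ ⟨
      N⁻¹ * 2^ (fromℕ n) * 2^ (- fromℕ n)   ≈⟨ *-congʳ (*-congˡ (2^-fromℕ n)) ⟩
      N⁻¹ * N * 2^ (- fromℕ n)
        ≈⟨ *-congʳ (trans (*-comm N⁻¹ N) (reciprocal-inverse N N>0)) ⟩
      1# * 2^ (- fromℕ n)            ≈⟨ *-identityˡ _ ⟩
      2^ (- fromℕ n)                 ∎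
      where open ≈-Reasoning
    0<n+x : 0# < fromℕ n + x
    0<n+x = <-respˡ-≈ (-‿inverseˡ x) (+-monoˡ-< x (proj₂ (archimedean (- x))))
    -n<x : - fromℕ n < x
    -n<x = +-cancelˡ-< (fromℕ n) (<-respˡ-≈ (sym (-‿inverseʳ (fromℕ n))) 0<n+x)

  -- The fraction is `k` over `n`. Without a decidable order an integer above `nx` can only be
  -- located within a window of length 2, so `n` is taken with `n (y - x) > 2`.
  between : ∀ {x y} → 0# < x → x < y →
            ∃[ k ] ∃[ n ] fromℕ n * x < fromℕ k × fromℕ k < fromℕ n * y
  between {x} {y} 0<x x<y =
    let k , nx<k , k<nx+2 = search (proj₁ (archimedean (nx + 1#))) 0
                              (ℕₚ.m≤m+n _ 0) 0<nx+1
    in k , n , nx<k , <-trans k<nx+2 nx+2<ny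
    where
    d⁺ : ℝ⁺
    d⁺ = y - x , x<y⇒0<y-x x<y
    n = proj₁ (archimedean (fromℕ 2 / d⁺))
    nx = fromℕ n * x
    2<nd : fromℕ 2 < fromℕ n * (y - x)
    2<nd = <-respˡ-≈ (x/y*y≈x (fromℕ 2) d⁺)
      (*-monoˡ-< (proj₂ d⁺) (proj₂ (archimedean (fromℕ 2 / d⁺))))
    nx+2<ny : nx + fromℕ 2 < fromℕ n * y
    nx+2<ny = <-respʳ-≈
      (trans (+-congˡ (x*[y-z]≈x*y-x*z (fromℕ n) y x)) (x+[y-x]≈y _ _))
      (+-monoʳ-< nx 2<nd)
    nx<nx+1 : nx < nx + 1#
    nx<nx+1 = <-respˡ-≈ (+-identityʳ nx) (+-monoʳ-< nx 0<1)
    0<nx+1 : 0# < nx + 1#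
    0<nx+1 = ≤-<-trans (*-nonNegative (fromℕ-nonNegative n) (<⇒≤ 0<x)) nx<nx+1
    1+[nx+1]≈nx+2 : 1# + (nx + 1#) ≈ nx + fromℕ 2
    1+[nx+1]≈nx+2 = begin
      1# + (nx + 1#)      ≈⟨ +-comm 1# (nx + 1#) ⟩
      nx + 1# + 1#        ≈⟨ +-assoc nx 1# 1# ⟩
      nx + (1# + 1#)      ≈⟨ +-congˡ (+-congˡ (+-identityʳ 1#)) ⟨
      nx + fromℕ 2        ∎
      where open ≈-Reasoning
    -- `fuel + k` never drops below an integer exceeding `nx + 1`, so the invariant `k < nx + 1`
    -- forbids running out of fuel. When the search stops at `k + 1`, the same invariant gives the
    -- upper bound `nx + 2`.
    search : ∀ fuel k → proj₁ (archimedean (nx + 1#)) ℕ.≤ fuel ℕ.+ k → fromℕ k < nx + 1# →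
             ∃[ k′ ] nx < fromℕ k′ × fromℕ k′ < nx + fromℕ 2
    search zero       k M≤k k<nx+1 = contradiction
      (<-trans k<nx+1 (proj₂ (archimedean (nx + 1#)))) (fromℕ-mono-≤ M≤k)
    search (suc fuel) k M≤k k<nx+1 with <-cotransitive nx<nx+1 (fromℕ (suc k))
    ... | inj₁ nx<1+k = suc k , nx<1+k , <-respʳ-≈ 1+[nx+1]≈nx+2 (+-monoʳ-< 1# k<nx+1)
    ... | inj₂ 1+k<nx+1 = search fuel (suc k)
      (ℕₚ.≤-trans M≤k (ℕₚ.≤-reflexive (≡.sym (ℕₚ.+-suc fuel k)))) 1+k<nx+1

  -- Otherwise some fraction k/n lies strictly between x and 1 - 2⁻ˣ, and with
  -- j = n - k this gives nⁿ < 2ᵏ jⁿ.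
  1-x≤2^-x : ∀ {x} → 0# < x → 1# - x ≤ 2^ (- x)
  1-x≤2^-x {x} 0<x e<1-x = refute (between 0<x x<1-e)
    where
    e = 2^ (- x)
    x<1-e : x < 1# - e
    x<1-e = <-respˡ-≈ ([x+y]-x≈y e x) (+-monoˡ-< (- e)
      (<-respʳ-≈ (trans (+-comm (1# - x) x) (x+[y-x]≈y x 1#)) (+-monoˡ-< x e<1-x)))
    refute : ¬ (∃[ k ] ∃[ n ] fromℕ n * x < fromℕ k × fromℕ k < fromℕ n * (1# - e))
    refute (k , n , nx<k , k<n[1-e]) = <-irrefl refl N^n<N^n
      where
      N = fromℕ n
      K = fromℕ k
      k+ne<n : K + N * e < N
      k+ne<n = <-respʳ-≈ eq (+-monoˡ-< (N * e) k<n[1-e])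
        where
        eq : N * (1# - e) + N * e ≈ N
        eq = begin
          N * (1# - e) + N * e       ≈⟨ +-comm _ _ ⟩
          N * e + N * (1# - e)       ≈⟨ +-congˡ (x*[y-z]≈x*y-x*z N 1# e) ⟩
          N * e + (N * 1# - N * e)   ≈⟨ x+[y-x]≈y _ _ ⟩
          N * 1#                     ≈⟨ *-identityʳ N ⟩
          N                          ∎
          where open ≈-Reasoning
      0≤ne : 0# ≤ N * e
      0≤ne = *-nonNegative (fromℕ-nonNegative n) (<⇒≤ (2^-positive (- x)))
      k<n : K < N
      k<n = ≤-<-trans (≤-trans (≤-reflexive (sym (+-identityʳ K))) (+-monoʳ-≤ K 0≤ne)) k+ne<n
      k≤n : k ℕ.≤ n
      k≤n with ℕₚ.≤-total k n
      ... | inj₁ k≤n = k≤n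
      ... | inj₂ n≤k = contradiction k<n (fromℕ-mono-≤ n≤k)
      j = n ℕ.∸ k
      k+j≡n : k ℕ.+ j ≡ n
      k+j≡n = ℕₚ.m+[n∸m]≡n k≤n
      ne<j : N * e < fromℕ j
      ne<j = +-cancelˡ-< K (<-respʳ-≈
        (trans (reflexive (≡.cong fromℕ (≡.sym k+j≡n))) (fromℕ-homo-+ k j)) k+ne<n)
      1<2^k*e^n : 1# < fromℕ 2 ^ k * e ^ n
      1<2^k*e^n = <-respˡ-≈ 2^0≈1 (<-respʳ-≈ eq
        (2^-mono-< (x<y⇒0<y-x nx<k)))
        where
        eq : 2^ (K - N * x) ≈ fromℕ 2 ^ k * e ^ n
        eq = begin
          2^ (K - N * x)           ≈⟨ 2^-homo-+ K (- (N * x)) ⟩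
          2^ K * 2^ (- (N * x))    ≈⟨ *-cong (2^-fromℕ k) (2^-cong (-‿distribʳ-* N x)) ⟩
          fromℕ 2 ^ k * 2^ (N * - x) ≈⟨ *-congˡ (2^-homo-fromℕ* n (- x)) ⟩
          fromℕ 2 ^ k * e ^ n      ∎
          where open ≈-Reasoning
      N^n<N^n : N ^ n < N ^ n
      N^n<N^n = begin-strict
        N ^ n                         ≈⟨ *-identityʳ _ ⟨
        N ^ n * 1#
          <⟨ *-monoʳ-< (^-positive n (≤-<-trans (fromℕ-nonNegative k) k<n)) 1<2^k*e^n ⟩
        N ^ n * (fromℕ 2 ^ k * e ^ n) ≈⟨ *-assoc _ _ _ ⟨
        N ^ n * fromℕ 2 ^ k * e ^ n   ≈⟨ *-congʳ (*-comm _ _) ⟩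
        fromℕ 2 ^ k * N ^ n * e ^ n   ≈⟨ *-assoc _ _ _ ⟩
        fromℕ 2 ^ k * (N ^ n * e ^ n) ≈⟨ *-congˡ (^-distrib-* N e n) ⟨
        fromℕ 2 ^ k * (N * e) ^ n
          ≤⟨ *-monoʳ-≤ (^-nonNegative k (fromℕ-nonNegative 2)) (^-mono-≤ n 0≤ne (<⇒≤ ne<j)) ⟩
        fromℕ 2 ^ k * fromℕ j ^ n     ≈⟨ *-cong (fromℕ-homo-^ 2 k) (fromℕ-homo-^ j n) ⟨
        fromℕ (2 ℕ.^ k) * fromℕ (j ℕ.^ n) ≈⟨ fromℕ-homo-* (2 ℕ.^ k) (j ℕ.^ n) ⟨
        fromℕ (2 ℕ.^ k ℕ.* j ℕ.^ n)
          ≤⟨ fromℕ-mono-≤ (2^k*j^n≤[k+j]^n k j (ℕₚ.≤-reflexive k+j≡n)) ⟩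
        fromℕ ((k ℕ.+ j) ℕ.^ n)       ≡⟨ ≡.cong (λ i → fromℕ (i ℕ.^ n)) k+j≡n ⟩
        fromℕ (n ℕ.^ n)               ≈⟨ fromℕ-homo-^ n n ⟩
        N ^ n                         ∎
        where open ≤-Reasoning

-- Finite sums and products.

module Sums {c ℓ₁ ℓ₂} (R : RealNumbers c ℓ₁ ℓ₂) where

  open RealProperties R

  sum-mono-≤ : ∀ {n} {f g : Fin n → ℝ} → (∀ i → f i ≤ g i) → sum f ≤ sum g
  sum-mono-≤ {zero}  f≤g = ≤-refl
  sum-mono-≤ {suc n} f≤g = +-mono-≤ (f≤g zero) (sum-mono-≤ (f≤g ∘ suc))

  sum-zero : ∀ {n} {f : Fin n → ℝ} → (∀ i → f i ≈ 0#) → sum f ≈ 0#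
  sum-zero {n} f≈0 = trans (sum-cong-≋ f≈0) (sum-replicate-zero n)

  sum-nonNegative : ∀ {n} {f : Fin n → ℝ} → (∀ i → 0# ≤ f i) → 0# ≤ sum f
  sum-nonNegative {n} 0≤f =
    ≤-trans (≤-reflexive (sym (sum-replicate-zero n))) (sum-mono-≤ 0≤f)

  sum-const : ∀ n x → sum {n} (λ _ → x) ≈ fromℕ n * x
  sum-const zero    x = sym (zeroˡ x)
  sum-const (suc n) x = begin
    x + sum {n} (λ _ → x)   ≈⟨ +-cong (sym (*-identityˡ x)) (sum-const n x) ⟩
    1# * x + fromℕ n * x    ≈⟨ distribʳ x 1# (fromℕ n) ⟨
    (1# + fromℕ n) * x      ∎
    where open ≈-Reasoning

  term≤sum : ∀ {n} {f : Fin n → ℝ} → (∀ i → 0# ≤ f i) → ∀ i → f i ≤ sum f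
  term≤sum {suc n} {f} 0≤f zero = begin
    f zero                ≈⟨ +-identityʳ _ ⟨
    f zero + 0#           ≤⟨ +-monoʳ-≤ _ (sum-nonNegative (0≤f ∘ suc)) ⟩
    f zero + sum (f ∘ suc) ∎
    where open ≤-Reasoning
  term≤sum {suc n} {f} 0≤f (suc i) = begin
    f (suc i)             ≤⟨ term≤sum (0≤f ∘ suc) i ⟩
    sum (f ∘ suc)         ≈⟨ +-identityˡ _ ⟨
    0# + sum (f ∘ suc)    ≤⟨ +-monoˡ-≤ _ (0≤f zero) ⟩
    f zero + sum (f ∘ suc) ∎
    where open ≤-Reasoning

  product-nonNegative : ∀ {n} {f : Fin n → ℝ} → (∀ i → 0# ≤ f i) → 0# ≤ product f
  product-nonNegative {zero}  0≤f = 0≤1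
  product-nonNegative {suc n} 0≤f = *-nonNegative (0≤f zero) (product-nonNegative (0≤f ∘ suc))

  product-mono-≤ : ∀ {n} {f g : Fin n → ℝ} → (∀ i → 0# ≤ f i) → (∀ i → f i ≤ g i) →
                   product f ≤ product g
  product-mono-≤ {zero}  0≤f f≤g = ≤-refl
  product-mono-≤ {suc n} 0≤f f≤g = *-mono-≤ (0≤f zero) (product-nonNegative (0≤f ∘ suc))
    (f≤g zero) (product-mono-≤ (0≤f ∘ suc) (f≤g ∘ suc))

  product-one : ∀ {n} {f : Fin n → ℝ} → (∀ i → f i ≈ 1#) → product f ≈ 1#
  product-one {zero}  f≈1 = refl
  product-one {suc n} f≈1 =
    trans (*-cong (f≈1 zero) (product-one (f≈1 ∘ suc))) (*-identityˡ 1#)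

  product-zero : ∀ {n} (f : Fin n → ℝ) i → f i ≈ 0# → product f ≈ 0#
  product-zero f zero    fi≈0 = trans (*-congʳ fi≈0) (zeroˡ _)
  product-zero f (suc i) fi≈0 = trans (*-congˡ (product-zero (f ∘ suc) i fi≈0)) (zeroʳ _)

  product-single : ∀ {n} (w : Fin n) x →
                   product (λ i → if does (i Finₚ.≟ w) then x else 1#) ≈ x
  product-single {suc n} zero    x =
    trans (*-congˡ (product-one {n} (λ _ → refl))) (*-identityʳ x)
  product-single {suc n} (suc w) x = trans (*-identityˡ _) (product-single w x)

  -- Products over `Γ f` and `U σ` become products over all flaws, with factor 1 outside the list,
  -- so that they can be multiplied and compared flaw by flaw.
  ∏-filter-tabulate : ∀ {n a p} {A : Set a} {P : A → Set p} (P? : Decidable P)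
    (h : A → ℝ) (f : Fin n → A) →
    ∏ (filter P? (List.tabulate f)) h ≈ product (λ i → if does (P? (f i)) then h (f i) else 1#)
  ∏-filter-tabulate {zero}  P? h f = refl
  ∏-filter-tabulate {suc n} P? h f with does (P? (f zero))
  ... | true  = *-congˡ (∏-filter-tabulate P? h (f ∘ suc))
  ... | false = trans (∏-filter-tabulate P? h (f ∘ suc)) (sym (*-identityˡ _))

  ∏≤^length : ∀ {a} {A : Set a} (xs : List A) {h : A → ℝ} {y} →
              (∀ x → 0# ≤ h x) → (∀ x → h x ≤ y) →
              ∏ xs h ≤ y ^ List.length xs
  ∏≤^length []       0≤h h≤y = ≤-refl
  ∏≤^length (x ∷ xs) 0≤h h≤y = *-mono-≤ (0≤h x) (nonNegative xs) (h≤y x) (∏≤^length xs 0≤h h≤y)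
    where
    nonNegative : ∀ xs → 0# ≤ ∏ xs _
    nonNegative []       = 0≤1
    nonNegative (x ∷ xs) = *-nonNegative (0≤h x) (nonNegative xs)

  ∑Vec-cong : ∀ {n} t {f g : Vec (Fin n) t → ℝ} → (∀ v → f v ≈ g v) → ∑Vec t f ≈ ∑Vec t g
  ∑Vec-cong zero    f≈g = f≈g []
  ∑Vec-cong (suc t) f≈g = sum-cong-≋ λ i → ∑Vec-cong t λ v → f≈g (i ∷ v)

  ∑Vec-mono-≤ : ∀ {n} t {f g : Vec (Fin n) t → ℝ} → (∀ v → f v ≤ g v) → ∑Vec t f ≤ ∑Vec t g
  ∑Vec-mono-≤ zero    f≤g = f≤g []
  ∑Vec-mono-≤ (suc t) f≤g = sum-mono-≤ λ i → ∑Vec-mono-≤ t λ v → f≤g (i ∷ v)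

  ∑Vec-zero : ∀ {n} t {f : Vec (Fin n) t → ℝ} → (∀ v → f v ≈ 0#) → ∑Vec t f ≈ 0#
  ∑Vec-zero zero    f≈0 = f≈0 []
  ∑Vec-zero (suc t) f≈0 = sum-zero λ i → ∑Vec-zero t λ v → f≈0 (i ∷ v)

  *-distribˡ-∑Vec : ∀ {n} t x (f : Vec (Fin n) t → ℝ) → x * ∑Vec t f ≈ ∑Vec t (λ v → x * f v)
  *-distribˡ-∑Vec zero    x f = refl
  *-distribˡ-∑Vec (suc t) x f = trans (*-distribˡ-sum x (λ i → ∑Vec t λ v → f (i ∷ v)))
    (sum-cong-≋ λ i → *-distribˡ-∑Vec t x λ v → f (i ∷ v))

  *-distribʳ-∑Vec : ∀ {n} t x (f : Vec (Fin n) t → ℝ) → ∑Vec t f * x ≈ ∑Vec t (λ v → f v * x)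
  *-distribʳ-∑Vec t x f =
    trans (*-comm _ _) (trans (*-distribˡ-∑Vec t x f) (∑Vec-cong t λ v → *-comm _ _))

  ∑Vec-nonNegative : ∀ {n} t {f : Vec (Fin n) t → ℝ} → (∀ v → 0# ≤ f v) → 0# ≤ ∑Vec t f
  ∑Vec-nonNegative zero    0≤f = 0≤f []
  ∑Vec-nonNegative (suc t) 0≤f = sum-nonNegative λ i → ∑Vec-nonNegative t λ v → 0≤f (i ∷ v)

  sum-∑Vec-comm : ∀ {m n} t (f : Fin m → Vec (Fin n) t → ℝ) →
                  sum (λ i → ∑Vec t (f i)) ≈ ∑Vec t (λ v → sum (λ i → f i v))
  sum-∑Vec-comm         zero    f = refl
  sum-∑Vec-comm {m} {n} (suc t) f = trans (∑-comm {m} {n} (λ i j → ∑Vec t λ v → f i (j ∷ v)))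
    (sum-cong-≋ λ j → sum-∑Vec-comm t λ i v → f i (j ∷ v))

  ∑Vec-comm : ∀ {m n} s t (f : Vec (Fin m) s → Vec (Fin n) t → ℝ) →
              ∑Vec s (λ u → ∑Vec t (f u)) ≈ ∑Vec t (λ v → ∑Vec s (λ u → f u v))
  ∑Vec-comm zero    t f = refl
  ∑Vec-comm (suc s) t f = trans (sum-cong-≋ λ i → ∑Vec-comm s t λ u → f (i ∷ u))
    (sum-∑Vec-comm t λ i v → ∑Vec s λ u → f (i ∷ u) v)

  -- Expanding a product of sums picks one index in each factor. For two indices this runs over all
  -- subsets, and it is how every sum over sets of flaws is evaluated.
  ∑Vec-product : ∀ {n} t (f : Fin t → Fin n → ℝ) →
                 ∑Vec t (λ v → product (λ i → f i (lookup v i))) ≈ product (λ i → sum (f i))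
  ∑Vec-product zero    f = refl
  ∑Vec-product (suc t) f = begin
    sum (λ j → ∑Vec t (λ v → f zero j * p v))
      ≈⟨ sum-cong-≋ (λ j → *-distribˡ-∑Vec t (f zero j) p) ⟨
    sum (λ j → f zero j * ∑Vec t p)            ≈⟨ *-distribʳ-sum (∑Vec t p) (f zero) ⟨
    sum (f zero) * ∑Vec t p                    ≈⟨ *-congˡ (∑Vec-product t (f ∘ suc)) ⟩
    sum (f zero) * product (λ i → sum (f (suc i))) ∎
    where
    open ≈-Reasoning
    p = λ v → product (λ i → f (suc i) (lookup v i))

  ⟦_⟧ : Bool → ℝ
  ⟦ b ⟧ = if b then 1# else 0#

  ⟦⟧-nonNegative : ∀ b → 0# ≤ ⟦ b ⟧
  ⟦⟧-nonNegative true  = 0≤1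
  ⟦⟧-nonNegative false = ≤-refl

  sum-atMostOne : ∀ {n p} {P : Fin n → Set p} (P? : Decidable P) →
                  (∀ {i j} → P i → P j → i ≡ j) → sum (λ i → ⟦ does (P? i) ⟧) ≤ 1#
  sum-atMostOne {zero}  P? unique = 0≤1
  sum-atMostOne {suc n} P? unique with P? zero
  ... | no  _  = ≤-trans (≤-reflexive (+-identityˡ _))
    (sum-atMostOne (P? ∘ suc) λ pi pj → Finₚ.suc-injective (unique pi pj))
  ... | yes p₀ = ≤-reflexive (trans (+-congˡ (sum-zero rest≈0)) (+-identityʳ 1#))
    where
    rest≈0 : ∀ i → ⟦ does (P? (suc i)) ⟧ ≈ 0#
    rest≈0 i with P? (suc i)
    ... | yes pᵢ = contradiction (unique p₀ pᵢ) λ ()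
    ... | no  _  = refl

-- Amenabilities and greatest flaws.

minimum≤ : ∀ {k} (t : Fin (suc k) → ℕ) i → Vec.foldr₁ ℕ._⊓_ (Vec.tabulate t) ℕ.≤ t i
minimum≤ {zero}  t zero    = ℕₚ.≤-refl
minimum≤ {suc k} t zero    = ℕₚ.m⊓n≤m (t zero) _
minimum≤ {suc k} t (suc i) = ℕₚ.≤-trans (ℕₚ.m⊓n≤n (t zero) _) (minimum≤ (t ∘ suc) i)

module FlawSystemProperties {n m} (S : FlawSystem n m) where

  open FlawSystem S

  amenability≤∣A∣ : ∀ {f σ} → Present f σ → amenability f ℕ.≤ ∣ A f σ ∣
  amenability≤∣A∣ {f} {σ} σ∈f = All.lookup (Data.List.Extrema.Nat.min≤xs _ _)
    (∈-map⁺ (λ σ → ∣ A f σ ∣) (∈-filter⁺ (present? f) (∈-allFin σ) σ∈f))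

  module _ {_≼_ : Rel F 0ℓ} (π : IsTotalOrder _≡_ _≼_) where

    open Priority π
    open Data.List.Extrema totalOrder
      using (⊥≤max; xs≤max; argmax-all) renaming (max to greatest)

    greatest-filter : ∀ {p} {P : F → Set p} (P? : Decidable P) {f fs} →
                      filter P? (allFin (suc m)) ≡ f ∷ fs →
                      P (greatest f fs) × (∀ g → P g → g ≼ greatest f fs)
    greatest-filter {P = P} P? {f} {fs} eq
      with ≡.subst (All.All P) eq (all-filter P? (allFin (suc m)))
    ... | pf All.∷ pfs = argmax-all id pf pfs , λ g pg →
      All.lookup (⊥≤max f fs All.∷ xs≤max f fs) (≡.subst (_ ∈ˡ_) eq (∈-filter⁺ P? (∈-allFin g) pg))

    filter-empty : ∀ {p} {P : F → Set p} (P? : Decidable P) → filter P? (allFin (suc m)) ≡ [] →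
                   ∀ g → ¬ P g
    filter-empty P? eq g pg with () ← ≡.subst (_ ∈ˡ_) eq (∈-filter⁺ P? (∈-allFin g) pg)

    IsGreatest : ∀ {p} → (F → Set p) → F → Set p
    IsGreatest P w = P w × (∀ g → P g → g ≼ w)

    empty-or-greatest : ∀ {p} {P : F → Set p} → Decidable P →
                        (∀ g → ¬ P g) ⊎ ∃[ w ] IsGreatest P w
    empty-or-greatest P? with filter P? (allFin (suc m)) in eq
    ... | []     = inj₁ (filter-empty P? eq)
    ... | f ∷ fs = inj₂ (greatest f fs , greatest-filter P? eq)

    I-cases : ∀ σ → (I σ ≡ nothing × Sink σ) ⊎
                    ∃[ w ] (I σ ≡ just w × IsGreatest (λ g → Present g σ) w)
    I-cases σ with U σ in eq
    ... | []     =
      inj₁ (≡.refl , λ (f , _ , σ∈f , _) → filter-empty (λ f → present? f σ) eq f σ∈f)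
    ... | f ∷ fs = inj₂ (greatest f fs , ≡.refl , greatest-filter (λ f → present? f σ) eq)

  present⇒¬sink : ∀ {w σ} → Present w σ → ¬ Sink σ
  present⇒¬sink {w} {σ} σ∈w sink with A-nontrivial w σ σ∈w
  ... | τ , τ∈A , _ = sink (w , τ , σ∈w , τ∈A)

-- The walk and its probability of missing the sinks.

module WalkProperties {c ℓ₁ ℓ₂} (R : RealNumbers c ℓ₁ ℓ₂) {n m} (S : FlawSystem n m)
                      {_≼_ : Rel (FlawSystem.F S) 0ℓ} (π : IsTotalOrder _≡_ _≼_) where

  open RealProperties R
  open Sums R
  open FlawSystem S
  open FlawSystemProperties S
  open Priority π
  open Walk R S π public

  -- `reciprocal` takes a proof of positivity, and two such proofs need not be equal. Antitonicity
  -- in both directions together with tightness shows that the value does not depend on the proof.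
  uniform-∈ : ∀ {B τ} → τ ∈ B → (B>0 : 0 ℕ.< ∣ B ∣) → uniform B τ ≈ 1# / fromℕ⁺ ∣ B ∣ B>0
  uniform-∈ {B} {τ} τ∈B B>0 with τ ∈? B
  ... | yes _  = <-tight (reciprocal-antitone _ _ ≤-refl) (reciprocal-antitone _ _ ≤-refl)
  ... | no τ∉B = contradiction τ∈B τ∉B

  uniform-∉ : ∀ {B τ} → ¬ τ ∈ B → uniform B τ ≈ 0#
  uniform-∉ {B} {τ} τ∉B with τ ∈? B
  ... | yes τ∈B = contradiction τ∈B τ∉B
  ... | no  _   = refl

  uniform-nonNegative : ∀ B τ → 0# ≤ uniform B τ
  uniform-nonNegative B τ with τ ∈? B
  ... | yes τ∈B = <⇒≤ (0</ (fromℕ⁺ ∣ B ∣ (∣p∣>0 τ∈B)) 0<1)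
  ... | no _    = ≤-refl

  sum-indicator : ∀ {k} (B : Subset k) x →
                  sum (λ τ → if does (τ ∈? B) then x else 0#) ≈ fromℕ ∣ B ∣ * x
  sum-indicator []            x = sym (zeroˡ x)
  sum-indicator (outside ∷ B) x = trans (+-identityˡ _) (sum-indicator B x)
  sum-indicator (inside ∷ B)  x = trans
    (+-cong (sym (*-identityˡ x)) (sum-indicator B x)) (sym (distribʳ x 1# (fromℕ ∣ B ∣)))

  sum-uniform : ∀ B → 0 ℕ.< ∣ B ∣ → sum (uniform B) ≈ 1#
  sum-uniform B B>0 = begin
    sum (uniform B)   ≈⟨ sum-cong-≋ uniform≈ ⟩
    sum (λ τ → if does (τ ∈? B) then u else 0#) ≈⟨ sum-indicator B u ⟩
    fromℕ ∣ B ∣ * u   ≈⟨ *-comm _ _ ⟩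
    u * fromℕ ∣ B ∣   ≈⟨ x/y*y≈x 1# (fromℕ⁺ ∣ B ∣ B>0) ⟩
    1#                ∎
    where
    open ≈-Reasoning
    u = 1# / fromℕ⁺ ∣ B ∣ B>0
    uniform≈ : ∀ τ → uniform B τ ≈ (if does (τ ∈? B) then u else 0#)
    uniform≈ τ with τ ∈? B
    ... | yes τ∈B = <-tight (reciprocal-antitone _ _ ≤-refl) (reciprocal-antitone _ _ ≤-refl)
    ... | no  _   = refl

  -- Transition probabilities of the walk killed in the sinks.
  move : Ω → Ω → ℝ
  move σ τ = maybe′ (λ w → uniform (A w σ) τ) 0# (I σ)

  avoids-sinks : ℕ → Ω → ℝ
  avoids-sinks zero    σ = 1#
  avoids-sinks (suc T) σ = sum λ τ → move σ τ * avoids-sinks T τ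

  move-just : ∀ σ {w} → I σ ≡ just w → ∀ τ → move σ τ ≡ uniform (A w σ) τ
  move-just σ eq τ rewrite eq = ≡.refl

  transition-just : ∀ σ {w} → I σ ≡ just w → ∀ τ → transition σ τ ≡ uniform (A w σ) τ
  transition-just σ eq τ with I σ | eq
  ... | just _ | ≡.refl = ≡.refl

  move≡transition : ∀ σ {w} → I σ ≡ just w → ∀ τ → move σ τ ≡ transition σ τ
  move≡transition σ eq τ = ≡.trans (move-just σ eq τ) (≡.sym (transition-just σ eq τ))

  transition-nothing : ∀ σ → I σ ≡ nothing → ∀ τ → transition σ τ ≡ uniform ⁅ σ ⁆ τ
  transition-nothing σ eq τ with I σ | eq
  ... | nothing | ≡.refl = ≡.refl

  sum-transition : ∀ σ → sum (transition σ) ≈ 1#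
  sum-transition σ with I-cases π σ
  ... | inj₁ (eq , _) =
    trans (sum-cong-≋ {x = transition σ} {y = uniform ⁅ σ ⁆}
      λ τ → reflexive (transition-nothing σ eq τ))
    (sum-uniform ⁅ σ ⁆ (∣p∣>0 (x∈⁅x⁆ σ)))
  ... | inj₂ (w , eq , σ∈w , _) =
    trans (sum-cong-≋ {x = transition σ} {y = uniform (A w σ)}
      λ τ → reflexive (transition-just σ eq τ))
    (sum-uniform (A w σ) (A>0 σ∈w))

  ∑trajectoryProbability≈1 : ∀ t σ → ∑Vec t (trajectoryProbability σ) ≈ 1#
  ∑trajectoryProbability≈1 zero    σ = refl
  ∑trajectoryProbability≈1 (suc t) σ = begin
    sum (λ τ → ∑Vec t (λ v → transition σ τ * trajectoryProbability τ v))
      ≈⟨ sum-cong-≋ (λ τ → *-distribˡ-∑Vec t (transition σ τ) (trajectoryProbability τ)) ⟨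
    sum (λ τ → transition σ τ * ∑Vec t (trajectoryProbability τ))
      ≈⟨ sum-cong-≋ {y = transition σ} (λ τ → trans
           (*-congˡ (∑trajectoryProbability≈1 t τ)) (*-identityʳ _)) ⟩
    sum (transition σ)
      ≈⟨ sum-transition σ ⟩
    1# ∎
    where open ≈-Reasoning

  reaches-sink : ∀ {n} → Vec Ω n → Bool
  reaches-sink v = does (VecAny.any? sink? v)

  ℙ-sink : ∀ t {σ} → Sink σ → ℙ[reaches-sink-from σ within t steps] ≈ 1#
  ℙ-sink t {σ} sink = trans (∑Vec-cong t reached) (∑trajectoryProbability≈1 t σ)
    where
    reached :
      ∀ v → (if reaches-sink (σ ∷ v) then trajectoryProbability σ v else 0#) ≈
        trajectoryProbability σ v
    reached v rewrite dec-true (sink? σ) sink = refl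

  ℙ-¬sink : ∀ t {σ} → ¬ Sink σ → ℙ[reaches-sink-from σ within suc t steps] ≈
            sum λ τ → transition σ τ * ℙ[reaches-sink-from τ within t steps]
  ℙ-¬sink t {σ} ¬sink = sum-cong-≋ λ τ → trans (∑Vec-cong t (first-step τ))
    (sym (*-distribˡ-∑Vec t (transition σ τ) _))
    where
    first-step :
      ∀ τ v → (if reaches-sink (σ ∷ τ ∷ v) then trajectoryProbability σ (τ ∷ v) else 0#) ≈
                 transition σ τ * (if reaches-sink (τ ∷ v) then trajectoryProbability τ v else 0#)
    first-step τ v rewrite dec-false (sink? σ) ¬sink with reaches-sink (τ ∷ v)
    ... | true  = refl
    ... | false = sym (zeroʳ _)

  -- A walk that misses the sinks for t steps visits t + 1 flawed states.
  ℙ+avoids-sinks≈1 :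
    ∀ t σ → ℙ[reaches-sink-from σ within t steps] + avoids-sinks (suc t) σ ≈ 1#
  ℙ+avoids-sinks≈1 t σ with I-cases π σ
  ... | inj₁ (eq , sink) =
    trans (+-cong (ℙ-sink t sink)
      (sum-zero {f = λ τ → move σ τ * avoids-sinks t τ} stuck)) (+-identityʳ 1#)
    where
    stuck : ∀ τ → move σ τ * avoids-sinks t τ ≈ 0#
    stuck τ rewrite eq = zeroˡ _
  ℙ+avoids-sinks≈1 zero σ | inj₂ (w , eq , σ∈w , _) = begin
    ℙ[reaches-sink-from σ within zero steps] + sum (λ τ → move σ τ * 1#)
      ≈⟨ +-cong (unreached (present⇒¬sink σ∈w)) (sum-cong-≋ {x = λ τ → move σ τ * 1#}
           {y = transition σ} λ τ → trans (*-identityʳ _) (reflexive (move≡transition σ eq τ))) ⟩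
    0# + sum (transition σ)
      ≈⟨ +-identityˡ _ ⟩
    sum (transition σ)
      ≈⟨ sum-transition σ ⟩
    1# ∎
    where
    open ≈-Reasoning
    unreached : ¬ Sink σ → ℙ[reaches-sink-from σ within zero steps] ≈ 0#
    unreached ¬sink rewrite dec-false (sink? σ) ¬sink = refl
  ℙ+avoids-sinks≈1 (suc t) σ | inj₂ (w , eq , σ∈w , _) = begin
    ℙ[reaches-sink-from σ within suc t steps] + sum (λ τ → move σ τ * avoids-sinks (suc t) τ)
      ≈⟨ +-cong (ℙ-¬sink t (present⇒¬sink σ∈w)) (sum-cong-≋ {x = λ τ → move σ τ * Q τ}
           {y = λ τ → transition σ τ * Q τ} λ τ → *-congʳ (reflexive (move≡transition σ eq τ))) ⟩
    sum (λ τ → transition σ τ * P τ) + sum (λ τ → transition σ τ * Q τ)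
      ≈⟨ ∑-distrib-+ (λ τ → transition σ τ * P τ) (λ τ → transition σ τ * Q τ) ⟨
    sum (λ τ → transition σ τ * P τ + transition σ τ * Q τ)
      ≈⟨ sum-cong-≋ {y = transition σ} (λ τ → trans (sym (distribˡ _ _ _)) (trans
           (*-congˡ (ℙ+avoids-sinks≈1 t τ)) (*-identityʳ _))) ⟩
    sum (transition σ)
      ≈⟨ sum-transition σ ⟩
    1# ∎
    where
    open ≈-Reasoning
    P Q : Ω → ℝ
    P τ = ℙ[reaches-sink-from τ within t steps]
    Q τ = avoids-sinks (suc t) τ

-- The factor contributed by a single flaw.

module Indicators {c ℓ₁ ℓ₂} (R : RealNumbers c ℓ₁ ℓ₂) where

  open RealProperties R
  open Sums R

  -- A bit tells whether a flaw is pending. It lives in `Fin 2` so that `∑Vec` can range over all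
  -- sets of flaws, encoded as vectors of bits.
  absent pending : Fin 2 → ℝ
  absent zero     = 1#
  absent (suc _)  = 0#
  pending zero    = 0#
  pending (suc _) = 1#

  onlyIf : Bool → Fin 2 → ℝ
  onlyIf p zero    = 1#
  onlyIf p (suc _) = ⟦ p ⟧

  -- Unless it is the addressed one, a flaw is pending before a step iff it is
  -- pending after the step and was already present.
  backward : (addressed present : Bool) → Fin 2 → Fin 2 → ℝ
  backward true  _     b _  = pending b
  backward false true  b b′ = ⟦ does (b Finₚ.≟ b′) ⟧
  backward false false b _  = absent b

  -- The factor `onlyIf p′ b′` excludes a flaw that would remain pending although the move has
  -- removed it.
  compatible : (addressed present present′ : Bool) → Fin 2 → Fin 2 → ℝ
  compatible w p p′ b b′ = onlyIf p′ b′ * backward w p b b′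

  -- A majorant of `compatible` that has forgotten both states: it knows the flaw only through being
  -- addressed and being a neighbour in the causality digraph.
  forward : (addressed caused : Bool) → Fin 2 → Fin 2 → ℝ
  forward true  c b       b′ = onlyIf c b′
  forward false c zero    b′ = onlyIf c b′
  forward false c (suc _) b′ = pending b′

  weight : ℝ → Fin 2 → ℝ
  weight x zero    = 1#
  weight x (suc _) = x

  pending-nonNegative : ∀ b → 0# ≤ pending b
  pending-nonNegative zero    = ≤-refl
  pending-nonNegative (suc _) = 0≤1

  absent-nonNegative : ∀ b → 0# ≤ absent b
  absent-nonNegative zero    = 0≤1
  absent-nonNegative (suc _) = ≤-refl

  onlyIf-nonNegative : ∀ p b → 0# ≤ onlyIf p b
  onlyIf-nonNegative p zero    = 0≤1
  onlyIf-nonNegative p (suc _) = ⟦⟧-nonNegative p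

  backward-nonNegative : ∀ w p b b′ → 0# ≤ backward w p b b′
  backward-nonNegative true  _     b b′ = pending-nonNegative b
  backward-nonNegative false true  b b′ = ⟦⟧-nonNegative _
  backward-nonNegative false false b b′ = absent-nonNegative b

  compatible-nonNegative : ∀ w p p′ b b′ → 0# ≤ compatible w p p′ b b′
  compatible-nonNegative w p p′ b b′ =
    *-nonNegative (onlyIf-nonNegative p′ b′) (backward-nonNegative w p b b′)

  forward-nonNegative : ∀ w c b b′ → 0# ≤ forward w c b b′
  forward-nonNegative true  c b       b′ = onlyIf-nonNegative c b′
  forward-nonNegative false c zero    b′ = onlyIf-nonNegative c b′
  forward-nonNegative false c (suc _) b′ = pending-nonNegative b′

  weight-nonNegative : ∀ {x} → 0# ≤ x → ∀ b → 0# ≤ weight x b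
  weight-nonNegative 0≤x zero    = 0≤1
  weight-nonNegative 0≤x (suc _) = 0≤x

  absent≤weight : ∀ {x} → 0# ≤ x → ∀ b → absent b ≤ weight x b
  absent≤weight 0≤x zero    = ≤-refl
  absent≤weight 0≤x (suc _) = 0≤x

  onlyIf-mono-≤ : ∀ {p q} {P : Set p} {Q : Set q} (P? : Dec P) (Q? : Dec Q) → (P → Q) →
                  ∀ b → onlyIf (does P?) b ≤ onlyIf (does Q?) b
  onlyIf-mono-≤ P?      Q?       P⇒Q zero    = ≤-refl
  onlyIf-mono-≤ (no _)  Q?       P⇒Q (suc _) = ⟦⟧-nonNegative (does Q?)
  onlyIf-mono-≤ (yes _) (yes _)  P⇒Q (suc _) = ≤-refl
  onlyIf-mono-≤ (yes p) (no ¬q)  P⇒Q (suc _) = contradiction (P⇒Q p) ¬q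

  -- A flaw that becomes pending, or is addressed and pending again, is present after the move; it
  -- is the addressed flaw or was absent before, so the move causes it. Any other pending flaw keeps
  -- its bit.
  compatible≤forward :
    ∀ {w p p′ c} {W : Set w} {P : Set p} {P′ : Set p′} {C : Set c}
    (W? : Dec W) (P? : Dec P) (P′? : Dec P′) (C? : Dec C) → (P′ → W ⊎ ¬ P → C) →
    ∀ b b′ → compatible (does W?) (does P?) (does P′?) b b′ ≤ forward (does W?) (does C?) b b′
  compatible≤forward (yes w) P? P′? C? caused zero b′ =
    ≤-trans (≤-reflexive (zeroʳ _)) (onlyIf-nonNegative (does C?) b′)
  compatible≤forward (yes w) P? P′? C? caused (suc _) b′ =
    ≤-trans (≤-reflexive (*-identityʳ _)) (onlyIf-mono-≤ P′? C? (λ p′ → caused p′ (inj₁ w)) b′)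
  compatible≤forward (no ¬w) (no ¬p) P′? C? caused zero b′ =
    ≤-trans (≤-reflexive (*-identityʳ _)) (onlyIf-mono-≤ P′? C? (λ p′ → caused p′ (inj₂ ¬p)) b′)
  compatible≤forward (no ¬w) (no ¬p) P′? C? caused (suc _) b′ =
    ≤-trans (≤-reflexive (zeroʳ _)) (pending-nonNegative b′)
  compatible≤forward (no ¬w) (yes p) P′? C? caused zero zero = ≤-reflexive (*-identityʳ _)
  compatible≤forward (no ¬w) (yes p) P′? C? caused zero (suc _) =
    ≤-trans (≤-reflexive (zeroʳ _)) (⟦⟧-nonNegative (does C?))
  compatible≤forward (no ¬w) (yes p) P′? C? caused (suc _) zero = ≤-reflexive (zeroʳ _)
  compatible≤forward (no ¬w) (yes p) (yes _) C? caused (suc zero) (suc zero) =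
    ≤-reflexive (*-identityʳ _)
  compatible≤forward (no ¬w) (yes p) (no _) C? caused (suc zero) (suc zero) =
    ≤-trans (≤-reflexive (zeroˡ _)) 0≤1

  -- Exactly one `b` survives, since the bit before a move is determined by the bit after it. The
  -- addressed flaw has its bit forced to pending, and `W → P` lets that bit pass the test of
  -- presence.
  ∑onlyIf*backward≈1 : ∀ {w p} {W : Set w} {P : Set p} (W? : Dec W) (P? : Dec P) → (W → P) → ∀ b′ →
                       sum (λ b → onlyIf (does P?) b * backward (does W?) (does P?) b b′) ≈ 1#
  ∑onlyIf*backward≈1 (yes w) (no ¬p) W⇒P b′ = contradiction (W⇒P w) ¬p
  ∑onlyIf*backward≈1 (yes w) (yes p) W⇒P b′ = begin
    1# * 0# + (1# * 1# + 0#)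
      ≈⟨ +-cong (*-identityˡ 0#) (trans (+-identityʳ _) (*-identityˡ 1#)) ⟩
    0# + 1#                   ≈⟨ +-identityˡ 1# ⟩
    1#                        ∎
    where open ≈-Reasoning
  ∑onlyIf*backward≈1 (no ¬w) (no ¬p) W⇒P b′ = begin
    1# * 1# + (0# * 0# + 0#)  ≈⟨ +-cong (*-identityˡ 1#) (trans (+-identityʳ _) (zeroˡ 0#)) ⟩
    1# + 0#                   ≈⟨ +-identityʳ 1# ⟩
    1#                        ∎
    where open ≈-Reasoning
  ∑onlyIf*backward≈1 (no ¬w) (yes p) W⇒P zero = begin
    1# * 1# + (1# * 0# + 0#)
      ≈⟨ +-cong (*-identityˡ 1#) (trans (+-identityʳ _) (*-identityˡ 0#)) ⟩
    1# + 0#                   ≈⟨ +-identityʳ 1# ⟩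
    1#                        ∎
    where open ≈-Reasoning
  ∑onlyIf*backward≈1 (no ¬w) (yes p) W⇒P (suc zero) = begin
    1# * 0# + (1# * 1# + 0#)
      ≈⟨ +-cong (*-identityˡ 0#) (trans (+-identityʳ _) (*-identityˡ 1#)) ⟩
    0# + 1#                   ≈⟨ +-identityˡ 1# ⟩
    1#                        ∎
    where open ≈-Reasoning

  ∑onlyIf*compatible : ∀ {w p} {W : Set w} {P : Set p} (W? : Dec W) (P? : Dec P) →
    (W → P) → ∀ p′ b′ →
    sum (λ b → onlyIf (does P?) b * compatible (does W?) (does P?) p′ b b′) ≈ onlyIf p′ b′
  ∑onlyIf*compatible W? P? W⇒P p′ b′ = begin
    sum (λ b → s b * (onlyIf p′ b′ * k b))
      ≈⟨ sum-cong-≋ {x = λ b → s b * (onlyIf p′ b′ * k b)} {y = λ b → onlyIf p′ b′ * (s b * k b)}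
           (λ b → x∙yz≈y∙xz (s b) (onlyIf p′ b′) (k b)) ⟩
    sum (λ b → onlyIf p′ b′ * (s b * k b))  ≈⟨ *-distribˡ-sum (onlyIf p′ b′) (λ b → s b * k b) ⟨
    onlyIf p′ b′ * sum (λ b → s b * k b)    ≈⟨ *-congˡ (∑onlyIf*backward≈1 W? P? W⇒P b′) ⟩
    onlyIf p′ b′ * 1#                       ≈⟨ *-identityʳ _ ⟩
    onlyIf p′ b′                            ∎
    where
    open ≈-Reasoning
    s k : Fin 2 → ℝ
    s b = onlyIf (does P?) b
    k b = backward (does W?) (does P?) b b′

  ∑onlyIf*weight : ∀ p x → sum (λ b → onlyIf p b * weight x b) ≈ (if p then 1# + x else 1#)
  ∑onlyIf*weight true x = +-cong (*-identityˡ 1#) (trans (+-identityʳ _) (*-identityˡ x))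
  ∑onlyIf*weight false x =
    trans (+-cong (*-identityˡ 1#) (trans (+-identityʳ _) (zeroˡ x))) (+-identityʳ 1#)

  ∑onlyIf*absent : ∀ p → sum (λ b → onlyIf p b * absent b) ≈ 1#
  ∑onlyIf*absent p =
    trans (+-cong (*-identityˡ 1#) (trans (+-identityʳ _) (zeroʳ _))) (+-identityʳ 1#)

  1≤1+x : ∀ {x} → 0# ≤ x → 1# ≤ 1# + x
  1≤1+x {x} 0≤x = ≤-trans (≤-reflexive (sym (+-identityʳ 1#))) (+-monoʳ-≤ 1# 0≤x)

  -- Slack arises only for an unaddressed pending flaw: its bit is forced and contributes `x` once,
  -- while the right side charges a further `1# + x` if the flaw is also caused. This is the price
  -- of treating a union of overlapping sets as independent choices.
  ∑forward*weight : ∀ w c b {x} → 0# ≤ x → sum (λ b′ → forward w c b b′ * weight x b′) ≤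
                    (if w then 1# else weight x b) * (if c then 1# + x else 1#)
  ∑forward*weight true  c b       {x} 0≤x =
    ≤-reflexive (trans (∑onlyIf*weight c x) (sym (*-identityˡ _)))
  ∑forward*weight false c zero    {x} 0≤x =
    ≤-reflexive (trans (∑onlyIf*weight c x) (sym (*-identityˡ _)))
  ∑forward*weight false c (suc _) {x} 0≤x = begin
    0# * 1# + (1# * x + 0#)  ≈⟨ +-cong (zeroˡ 1#) (trans (+-identityʳ _) (*-identityˡ x)) ⟩
    0# + x                   ≈⟨ trans (+-identityˡ x) (sym (*-identityʳ x)) ⟩
    x * 1#                   ≤⟨ *-monoʳ-≤ 0≤x (1≤if c) ⟩
    x * (if c then 1# + x else 1#) ∎
    where
    open ≤-Reasoning
    1≤if : ∀ c → 1# ≤ (if c then 1# + x else 1#)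
    1≤if true  = 1≤1+x 0≤x
    1≤if false = ≤-refl

-- The parameters and the rate 1 - δ.

module ParameterProperties {c ℓ₁ ℓ₂} (R : RealNumbers c ℓ₁ ℓ₂) {n m} (S : FlawSystem n m)
                           (μ : FlawSystem.F S → RealNumbers.ℝ⁺ R) where

  open RealProperties R
  open Sums R
  open FlawSystem S
  open Parameters R S μ public

  μ>0 : ∀ f → 0# < value (μ f)
  μ>0 f = proj₂ (μ f)

  μ≥0 : ∀ f → 0# ≤ value (μ f)
  μ≥0 f = <⇒≤ (μ>0 f)

  load : F → ℝ
  load f = 1# / (μ f *⁺ A⁺ f) * ∏Γ f

  -- Links the quantity maximised in `δ` with the left side of `Condition`.
  load*μ : ∀ f → load f * value (μ f) ≈ 1# / A⁺ f * ∏Γ f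
  load*μ f = begin
    1# / (μ f *⁺ A⁺ f) * ∏Γ f * x      ≈⟨ *-congʳ (*-congʳ (*-identityˡ _)) ⟩
    z * ∏Γ f * x                       ≈⟨ xy∙z≈xz∙y z (∏Γ f) x ⟩
    z * x * ∏Γ f                       ≈⟨ *-congʳ z*x≈y⁻¹ ⟩
    1# / A⁺ f * ∏Γ f                   ∎
    where
    open ≈-Reasoning
    open Algebra.Solver.CommutativeMonoid *-commutativeMonoid
    x = value (μ f)
    y = value (A⁺ f)
    z = reciprocal (x * y) (proj₂ (μ f *⁺ A⁺ f))
    y⁻¹ = reciprocal y (proj₂ (A⁺ f))
    z*x≈y⁻¹ : z * x ≈ 1# * y⁻¹
    z*x≈y⁻¹ = begin
      z * x                ≈⟨ *-identityʳ _ ⟨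
      z * x * 1#           ≈⟨ *-congˡ (reciprocal-inverse y (proj₂ (A⁺ f))) ⟨
      z * x * (y * y⁻¹)
        ≈⟨ solve 4 (λ z x y i → (z ⊕ x) ⊕ (y ⊕ i) ⊜ ((x ⊕ y) ⊕ z) ⊕ i) refl z x y y⁻¹ ⟩
      x * y * z * y⁻¹      ≈⟨ *-congʳ (reciprocal-inverse (x * y) (proj₂ (μ f *⁺ A⁺ f))) ⟩
      1# * y⁻¹             ∎

  ∏Γ≈product : ∀ f → ∏Γ f ≈ product (λ g → if does (f ⟶? g) then 1# + value (μ g) else 1#)
  ∏Γ≈product f = ∏-filter-tabulate (f ⟶?_) (λ g → 1# + value (μ g)) id

  ∏Γ≥0 : ∀ f → 0# ≤ ∏Γ f
  ∏Γ≥0 f = ≤-trans (product-nonNegative nonNegative) (≤-reflexive (sym (∏Γ≈product f)))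
    where
    nonNegative : ∀ g → 0# ≤ (if does (f ⟶? g) then 1# + value (μ g) else 1#)
    nonNegative g with does (f ⟶? g)
    ... | true  = <⇒≤ (+-positive 0<1 (μ>0 g))
    ... | false = 0≤1

  load≥0 : ∀ f → 0# ≤ load f
  load≥0 f = *-nonNegative (<⇒≤ (0</ (μ f *⁺ A⁺ f) 0<1)) (∏Γ≥0 f)

  rate : ℝ
  rate = max load

  rate≥0 : 0# ≤ rate
  rate≥0 = ≤-trans (load≥0 zero) (t≤max load zero)

  -- The form in which the weights enter the induction: exchanging the factor `μ w` for the average
  -- weight of what `w` causes costs at most `rate`.
  ∏Γ/A≤rate*μ : ∀ f → 1# / A⁺ f * ∏Γ f ≤ rate * value (μ f)
  ∏Γ/A≤rate*μ f = ≤-trans (≤-reflexive (sym (load*μ f))) (*-monoˡ-≤ (μ≥0 f) (t≤max load f))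

  Condition⇒δ>0 : Condition → 0# < δ
  Condition⇒δ>0 condition = x<y⇒0<y-x (max-lub-< load load<1)
    where
    load<1 : ∀ f → load f < 1#
    load<1 f = <-respʳ-≈ (μ*μ⁻¹≈1) (<-respˡ-≈ eq
      (*-monoˡ-< (reciprocal-positive x x>0) (<-respˡ-≈ (sym (load*μ f)) (condition f))))
      where
      x = value (μ f)
      x>0 = proj₂ (μ f)
      μ*μ⁻¹≈1 = reciprocal-inverse x x>0
      eq : load f * x * reciprocal x x>0 ≈ load f
      eq = trans (*-assoc _ _ _) (trans (*-congˡ μ*μ⁻¹≈1) (*-identityʳ _))

-- Pending flaws and their probabilities.

module PendingFlaws {c ℓ₁ ℓ₂} (R : RealNumbers c ℓ₁ ℓ₂) {n m} (S : FlawSystem n m)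
                    (μ : FlawSystem.F S → RealNumbers.ℝ⁺ R)
                    {_≼_ : Rel (FlawSystem.F S) 0ℓ} (π : IsTotalOrder _≡_ _≼_) where

  open RealProperties R
  open Sums R
  open Indicators R
  open FlawSystem S
  open FlawSystemProperties S
  open Priority π
  open WalkProperties R S π
  open ParameterProperties R S μ

  FlawSet : Set
  FlawSet = Vec (Fin 2) (suc m)

  ∑FlawSet : (FlawSet → ℝ) → ℝ
  ∑FlawSet = ∑Vec (suc m)

  isAddressed : F → F → Bool
  isAddressed w g = does (g Finₚ.≟ w)

  isCaused : F → F → Bool
  isCaused w g = does (w ⟶? g)

  isPresent : Ω → F → Bool
  isPresent σ g = does (present? g σ)

  support : Ω → FlawSet → ℝ
  support σ E = product λ g → onlyIf (isPresent σ g) (lookup E g)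

  compatibleAt : F → Ω → Ω → FlawSet → FlawSet → F → ℝ
  compatibleAt w σ τ E E′ g =
    compatible (isAddressed w g) (isPresent σ g) (isPresent τ g) (lookup E g) (lookup E′ g)

  backwardᴱ : F → Ω → Ω → FlawSet → FlawSet → ℝ
  backwardᴱ w σ τ E E′ = product (compatibleAt w σ τ E E′)

  forwardᴱ : F → FlawSet → FlawSet → ℝ
  forwardᴱ w E E′ =
    product λ g → forward (isAddressed w g) (isCaused w g) (lookup E g) (lookup E′ g)

  weightᴱ : FlawSet → ℝ
  weightᴱ E = product λ g → weight (value (μ g)) (lookup E g)

  -- Transition weight for pairs of a state and its pending set. Like `move`, it is zero out of a
  -- sink.
  kernel : Ω → Ω → FlawSet → FlawSet → ℝ
  kernel σ τ E E′ = maybe′ (λ w → uniform (A w σ) τ * backwardᴱ w σ τ E E′) 0# (I σ)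

  -- Probability that the walk from σ makes T moves and that E is the set of the
  -- flaws present in σ which stay present until one of these moves addresses them.
  pendingProbability : ℕ → Ω → FlawSet → ℝ
  pendingProbability zero    σ E = product λ g → absent (lookup E g)
  pendingProbability (suc T) σ E =
    sum λ τ → ∑FlawSet λ E′ → kernel σ τ E E′ * pendingProbability T τ E′

  kernel-just :
    ∀ σ {w} → I σ ≡ just w → ∀ τ E E′ → kernel σ τ E E′ ≡ uniform (A w σ) τ * backwardᴱ w σ τ E E′
  kernel-just σ eq τ E E′ rewrite eq = ≡.refl

  support-nonNegative : ∀ σ E → 0# ≤ support σ E
  support-nonNegative σ E =
    product-nonNegative λ g → onlyIf-nonNegative (isPresent σ g) (lookup E g)

  weightᴱ-nonNegative : ∀ E → 0# ≤ weightᴱ E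
  weightᴱ-nonNegative E = product-nonNegative λ g → weight-nonNegative (μ≥0 g) (lookup E g)

  compatibleAt-nonNegative : ∀ w σ τ E E′ g → 0# ≤ compatibleAt w σ τ E E′ g
  compatibleAt-nonNegative w σ τ E E′ g = compatible-nonNegative
    (isAddressed w g) (isPresent σ g) (isPresent τ g) (lookup E g) (lookup E′ g)

  backwardᴱ-nonNegative : ∀ w σ τ E E′ → 0# ≤ backwardᴱ w σ τ E E′
  backwardᴱ-nonNegative w σ τ E E′ = product-nonNegative (compatibleAt-nonNegative w σ τ E E′)

  forwardᴱ-nonNegative : ∀ w E E′ → 0# ≤ forwardᴱ w E E′
  forwardᴱ-nonNegative w E E′ = product-nonNegative λ g →
    forward-nonNegative (isAddressed w g) (isCaused w g) (lookup E g) (lookup E′ g)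

  kernel-nonNegative : ∀ σ τ E E′ → 0# ≤ kernel σ τ E E′
  kernel-nonNegative σ τ E E′ with I σ
  ... | just w  =
    *-nonNegative (uniform-nonNegative (A w σ) τ) (backwardᴱ-nonNegative w σ τ E E′)
  ... | nothing = ≤-refl

  pendingProbability-nonNegative : ∀ T σ E → 0# ≤ pendingProbability T σ E
  pendingProbability-nonNegative zero    σ E =
    product-nonNegative λ g → absent-nonNegative (lookup E g)
  pendingProbability-nonNegative (suc T) σ E =
    sum-nonNegative λ τ → ∑Vec-nonNegative (suc m) λ E′ →
    *-nonNegative (kernel-nonNegative σ τ E E′) (pendingProbability-nonNegative T τ E′)

  ∑product*product : (f h : F → Fin 2 → ℝ) →
    ∑FlawSet (λ E → product (λ g → f g (lookup E g)) * product (λ g → h g (lookup E g))) ≈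
    product (λ g → sum λ b → f g b * h g b)
  ∑product*product f h = begin
    ∑FlawSet (λ E → product (λ g → f g (lookup E g)) * product (λ g → h g (lookup E g)))
      ≈⟨ ∑Vec-cong (suc m) (λ E → product-distrib-* (λ g → f g (lookup E g))
           (λ g → h g (lookup E g))) ⟨
    ∑FlawSet (λ E → product (λ g → f g (lookup E g) * h g (lookup E g)))
      ≈⟨ ∑Vec-product (suc m) (λ g b → f g b * h g b) ⟩
    product (λ g → sum λ b → f g b * h g b) ∎
    where open ≈-Reasoning

  -- For a fixed move and a set `E′` of flaws present in `τ`, a single `E` is compatible; summing
  -- over `E` therefore leaves the bare move.
  ∑support*kernel :
    ∀ σ τ E′ → ∑FlawSet (λ E → support σ E * kernel σ τ E E′) ≈ move σ τ * support τ E′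
  ∑support*kernel σ τ E′ with I-cases π σ
  ... | inj₁ (eq , _) rewrite eq = begin
    ∑FlawSet (λ E → support σ E * 0#)  ≈⟨ *-distribʳ-∑Vec (suc m) 0# (support σ) ⟨
    ∑FlawSet (support σ) * 0#          ≈⟨ zeroʳ _ ⟩
    0#                                 ≈⟨ zeroˡ _ ⟨
    0# * support τ E′                  ∎
    where open ≈-Reasoning
  ... | inj₂ (w , eq , σ∈w , _) = begin
    ∑FlawSet (λ E → support σ E * kernel σ τ E E′)
      ≈⟨ ∑Vec-cong (suc m) (λ E → *-congˡ {x = support σ E} (reflexive (kernel-just σ eq τ E E′))) ⟩
    ∑FlawSet (λ E → support σ E * (u * backwardᴱ w σ τ E E′))
      ≈⟨ ∑Vec-cong (suc m) (λ E → x∙yz≈y∙xz (support σ E) u (backwardᴱ w σ τ E E′)) ⟩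
    ∑FlawSet (λ E → u * (support σ E * backwardᴱ w σ τ E E′))
      ≈⟨ *-distribˡ-∑Vec (suc m) u (λ E → support σ E * backwardᴱ w σ τ E E′) ⟨
    u * ∑FlawSet (λ E → support σ E * backwardᴱ w σ τ E E′)
      ≈⟨ *-congˡ (∑product*product only compat) ⟩
    u * product (λ g → sum λ b → only g b * compat g b)
      ≈⟨ *-congˡ (product-cong {y = λ g → onlyIf (isPresent τ g) (lookup E′ g)} λ g →
           ∑onlyIf*compatible (g Finₚ.≟ w) (present? g σ) (λ { ≡.refl → σ∈w })
             (isPresent τ g) (lookup E′ g)) ⟩
    u * support τ E′
      ≡⟨ ≡.cong (_* support τ E′) (move-just σ eq τ) ⟨
    move σ τ * support τ E′ ∎
    where
    open ≈-Reasoning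
    u = uniform (A w σ) τ
    only compat : F → Fin 2 → ℝ
    only g     = onlyIf (isPresent σ g)
    compat g b = compatible (isAddressed w g) (isPresent σ g) (isPresent τ g) b (lookup E′ g)

  -- Every trajectory of `T` moves has exactly one set of pending flaws, so the events indexed by
  -- `E` partition the trajectories.
  avoids-sinks≈∑pending :
    ∀ T σ → avoids-sinks T σ ≈ ∑FlawSet (λ E → support σ E * pendingProbability T σ E)
  avoids-sinks≈∑pending zero σ = sym (trans
    (∑product*product (λ g → onlyIf (isPresent σ g)) (λ _ → absent))
    (product-one λ g → ∑onlyIf*absent (isPresent σ g)))
  avoids-sinks≈∑pending (suc T) σ = begin
    sum (λ τ → move σ τ * avoids-sinks T τ)
      ≈⟨ sum-cong-≋ {x = λ τ → move σ τ * avoids-sinks T τ}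
           {y = λ τ → ∑FlawSet λ E → support σ E * row E τ} step ⟩
    sum (λ τ → ∑FlawSet λ E → support σ E * row E τ)
      ≈⟨ sum-∑Vec-comm (suc m) (λ τ E → support σ E * row E τ) ⟩
    ∑FlawSet (λ E → sum λ τ → support σ E * row E τ)
      ≈⟨ ∑Vec-cong (suc m) (λ E → *-distribˡ-sum (support σ E) (row E)) ⟨
    ∑FlawSet (λ E → support σ E * pendingProbability (suc T) σ E) ∎
    where
    open ≈-Reasoning
    C = pendingProbability T
    row : FlawSet → Ω → ℝ
    row E τ = ∑FlawSet λ E′ → kernel σ τ E E′ * C τ E′
    step : ∀ τ → move σ τ * avoids-sinks T τ ≈ ∑FlawSet λ E → support σ E * row E τ
    step τ = begin
      move σ τ * avoids-sinks T τ
        ≈⟨ *-congˡ (avoids-sinks≈∑pending T τ) ⟩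
      move σ τ * ∑FlawSet (λ E′ → support τ E′ * C τ E′)
        ≈⟨ *-distribˡ-∑Vec (suc m) (move σ τ) (λ E′ → support τ E′ * C τ E′) ⟩
      ∑FlawSet (λ E′ → move σ τ * (support τ E′ * C τ E′))
        ≈⟨ ∑Vec-cong (suc m) (λ E′ → trans (sym (*-assoc (move σ τ) (support τ E′) (C τ E′)))
             (*-congʳ (sym (∑support*kernel σ τ E′)))) ⟩
      ∑FlawSet (λ E′ → ∑FlawSet (λ E → support σ E * kernel σ τ E E′) * C τ E′)
        ≈⟨ ∑Vec-cong (suc m) (λ E′ → *-distribʳ-∑Vec (suc m) (C τ E′)
             (λ E → support σ E * kernel σ τ E E′)) ⟩
      ∑FlawSet (λ E′ → ∑FlawSet λ E → support σ E * kernel σ τ E E′ * C τ E′)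
        ≈⟨ ∑Vec-comm (suc m) (suc m) (λ E′ E → support σ E * kernel σ τ E E′ * C τ E′) ⟩
      ∑FlawSet (λ E → ∑FlawSet λ E′ → support σ E * kernel σ τ E E′ * C τ E′)
        ≈⟨ ∑Vec-cong (suc m)
             (λ E → ∑Vec-cong (suc m) λ E′ → *-assoc (support σ E) (kernel σ τ E E′) (C τ E′)) ⟩
      ∑FlawSet (λ E → ∑FlawSet λ E′ → support σ E * (kernel σ τ E E′ * C τ E′))
        ≈⟨ ∑Vec-cong (suc m) (λ E → *-distribˡ-∑Vec (suc m) (support σ E)
             (λ E′ → kernel σ τ E E′ * C τ E′)) ⟨
      ∑FlawSet (λ E → support σ E * row E τ) ∎

  -- The bound for one move backward.

  Pending : FlawSet → F → Set
  Pending E g = lookup E g ≡ suc zero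

  pending? : ∀ E → Decidable (Pending E)
  pending? E g = lookup E g Finₚ.≟ suc zero

  ¬Pending⇒zero : ∀ E g → ¬ Pending E g → lookup E g ≡ zero
  ¬Pending⇒zero E g ¬pending with lookup E g
  ... | zero     = ≡.refl
  ... | suc zero = contradiction ≡.refl ¬pending

  backwardᴱ-unaddressed : ∀ w σ τ E E′ → ¬ Pending E w → backwardᴱ w σ τ E E′ ≈ 0#
  backwardᴱ-unaddressed w σ τ E E′ ¬pending = product-zero
    (compatibleAt w σ τ E E′) w factor≈0
    where
    factor≈0 : compatibleAt w σ τ E E′ w ≈ 0#
    factor≈0 rewrite dec-true (w Finₚ.≟ w) ≡.refl | ¬Pending⇒zero E w ¬pending = zeroʳ _

  backwardᴱ-absent :
    ∀ {w g} σ τ E E′ → ¬ g ≡ w → ¬ Present g σ → Pending E g → backwardᴱ w σ τ E E′ ≈ 0#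
  backwardᴱ-absent {w} {g} σ τ E E′ g≢w σ∉g pending = product-zero
    (compatibleAt w σ τ E E′) g factor≈0
    where
    factor≈0 : compatibleAt w σ τ E E′ g ≈ 0#
    factor≈0 rewrite dec-false (g Finₚ.≟ w) g≢w | dec-false (present? g σ) σ∉g | pending =
      zeroʳ _

  uniform≤1/A : ∀ {w σ τ} → Arc σ w τ → uniform (A w σ) τ ≤ 1# / A⁺ w
  uniform≤1/A {w} {σ} {τ} (σ∈w , τ∈A) = ≤-trans
    (≤-reflexive (uniform-∈ τ∈A (∣p∣>0 τ∈A)))
    (reciprocal-antitone (A⁺ w) (fromℕ⁺ ∣ A w σ ∣ (∣p∣>0 τ∈A)) (fromℕ-mono-≤ (amenability≤∣A∣ σ∈w)))

  backwardᴱ≤forwardᴱ : ∀ {w σ τ} → Arc σ w τ → ∀ E E′ → backwardᴱ w σ τ E E′ ≤ forwardᴱ w E E′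
  backwardᴱ≤forwardᴱ {w} {σ} {τ} arc E E′ = product-mono-≤
    (compatibleAt-nonNegative w σ τ E E′)
    (λ g → compatible≤forward (g Finₚ.≟ w) (present? g σ) (present? g τ) (w ⟶? g)
             -- By the definition of causality the arc travelled is itself a witness of `w ⟶ g`.
             (λ τ∈g cause → σ , τ , arc , τ∈g , cause) (lookup E g) (lookup E′ g))

  bound : F → FlawSet → FlawSet → ℝ
  bound w E E′ = 1# / A⁺ w * forwardᴱ w E E′

  bound-nonNegative : ∀ w E E′ → 0# ≤ bound w E E′
  bound-nonNegative w E E′ = *-nonNegative (<⇒≤ (0</ (A⁺ w) 0<1)) (forwardᴱ-nonNegative w E E′)

  arc-bound-nonNegative : ∀ σ τ w E E′ → 0# ≤ ⟦ does (arc? σ w τ) ⟧ * bound w E E′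
  arc-bound-nonNegative σ τ w E E′ =
    *-nonNegative (⟦⟧-nonNegative _) (bound-nonNegative w E E′)

  uniform*backwardᴱ≤arc*bound : ∀ {w σ} → Present w σ → ∀ τ E E′ →
    uniform (A w σ) τ * backwardᴱ w σ τ E E′ ≤ ⟦ does (arc? σ w τ) ⟧ * bound w E E′
  uniform*backwardᴱ≤arc*bound {w} {σ} σ∈w τ E E′ = split (arc? σ w τ)
    where
    split : (arc : Dec (Arc σ w τ)) →
            uniform (A w σ) τ * backwardᴱ w σ τ E E′ ≤ ⟦ does arc ⟧ * bound w E E′
    split (yes arc) = ≤-trans
      (*-mono-≤ (uniform-nonNegative (A w σ) τ) (backwardᴱ-nonNegative w σ τ E E′)
        (uniform≤1/A arc) (backwardᴱ≤forwardᴱ arc E E′))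
      (≤-reflexive (sym (*-identityˡ _)))
    split (no ¬arc) = ≤-reflexive (trans (*-congʳ (uniform-∉ λ τ∈A → ¬arc (σ∈w , τ∈A)))
      (trans (zeroˡ _) (sym (zeroˡ _))))

  -- The flaw addressed by a contributing move from σ is determined by E: all of
  -- E is present in σ, and the greatest flaw present in σ is in E.
  kernel≤arc*bound : ∀ {w E} → IsGreatest π (Pending E) w → ∀ σ τ E′ →
                     kernel σ τ E E′ ≤ ⟦ does (arc? σ w τ) ⟧ * bound w E E′
  kernel≤arc*bound {w} {E} (w-pending , w-greatest) σ τ E′ with I-cases π σ
  ... | inj₁ (eq , _) rewrite eq = arc-bound-nonNegative σ τ w E E′
  ... | inj₂ (v , eq , σ∈v , v-greatest) = ≤-trans
    (≤-reflexive (reflexive (kernel-just σ eq τ E E′)))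
    (split (pending? E v) (w Finₚ.≟ v) (present? w σ))
    where
    Bounded : Set _
    Bounded = uniform (A v σ) τ * backwardᴱ v σ τ E E′ ≤ ⟦ does (arc? σ w τ) ⟧ * bound w E E′
    vanishing : backwardᴱ v σ τ E E′ ≈ 0# → Bounded
    vanishing back≈0 = ≤-trans (≤-reflexive (trans (*-congˡ back≈0) (zeroʳ _)))
      (arc-bound-nonNegative σ τ w E E′)
    split : Dec (Pending E v) → Dec (w ≡ v) → Dec (Present w σ) → Bounded
    split (no ¬pending) _            _         =
      vanishing (backwardᴱ-unaddressed v σ τ E E′ ¬pending)
    split (yes _)       (yes ≡.refl) _         = uniform*backwardᴱ≤arc*bound σ∈v τ E E′
    split (yes _)       (no w≢v)     (no σ∉w)  =
      vanishing (backwardᴱ-absent σ τ E E′ w≢v σ∉w w-pending)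
    split (yes pending) (no w≢v)     (yes σ∈w) =
      contradiction (IsTotalOrder.antisym π (v-greatest w σ∈w) (w-greatest v pending)) w≢v

  -- The flaw addressed by the move would have to be pending.
  kernel-empty : ∀ {E} → (∀ g → ¬ Pending E g) → ∀ σ τ E′ → kernel σ τ E E′ ≈ 0#
  kernel-empty {E} empty σ τ E′ with I σ
  ... | nothing = refl
  ... | just w  = trans (*-congˡ (backwardᴱ-unaddressed w σ τ E E′ (empty w))) (zeroʳ _)

  -- The label `w` is fixed by `E` and `bound` does not involve `σ`, so only the number of arcs
  -- labelled `w` into `τ` matters; atomicity makes it at most one.
  ∑kernel≤bound : Atomic → ∀ {w E} → IsGreatest π (Pending E) w → ∀ τ E′ →
                  sum (λ σ → kernel σ τ E E′) ≤ bound w E E′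
  ∑kernel≤bound atomic {w} {E} w-greatest τ E′ = begin
    sum (λ σ → kernel σ τ E E′)
      ≤⟨ sum-mono-≤ {f = λ σ → kernel σ τ E E′} {g = λ σ → arcᵇ σ * bound w E E′}
           (λ σ → kernel≤arc*bound {E = E} w-greatest σ τ E′) ⟩
    sum (λ σ → arcᵇ σ * bound w E E′)            ≈⟨ *-distribʳ-sum (bound w E E′) arcᵇ ⟨
    sum arcᵇ * bound w E E′
      ≤⟨ *-monoˡ-≤ (bound-nonNegative w E E′) (sum-atMostOne (λ σ → arc? σ w τ) (atomic w τ)) ⟩
    1# * bound w E E′                            ≈⟨ *-identityˡ _ ⟩
    bound w E E′                                 ∎
    where
    open ≤-Reasoning
    arcᵇ : Ω → ℝ
    arcᵇ σ = ⟦ does (arc? σ w τ) ⟧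

  -- The weight of `E` without `w`, written so as to avoid dividing by `μ w`.
  restWeight : F → FlawSet → ℝ
  restWeight w E =
    product λ g → if isAddressed w g then 1# else weight (value (μ g)) (lookup E g)

  restWeight-nonNegative : ∀ w E → 0# ≤ restWeight w E
  restWeight-nonNegative w E = product-nonNegative nonNegative
    where
    nonNegative :
      ∀ g → 0# ≤ (if isAddressed w g then 1# else weight (value (μ g)) (lookup E g))
    nonNegative g with isAddressed w g
    ... | true  = 0≤1
    ... | false = weight-nonNegative (μ≥0 g) (lookup E g)

  restWeight*μ : ∀ {w E} → Pending E w → restWeight w E * value (μ w) ≈ weightᴱ E
  restWeight*μ {w} {E} pending = begin
    restWeight w E * value (μ w)
      ≈⟨ *-congˡ (product-single w (value (μ w))) ⟨
    restWeight w E * product (λ g → if isAddressed w g then value (μ w) else 1#)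
      ≈⟨ product-distrib-* rest single ⟨
    product (λ g → rest g * single g)
      ≈⟨ product-cong {x = λ g → rest g * single g}
           {y = λ g → weight (value (μ g)) (lookup E g)} merge ⟩
    weightᴱ E ∎
    where
    open ≈-Reasoning
    rest single : F → ℝ
    rest g   = if isAddressed w g then 1# else weight (value (μ g)) (lookup E g)
    single g = if isAddressed w g then value (μ w) else 1#
    merge : ∀ g → rest g * single g ≈ weight (value (μ g)) (lookup E g)
    merge g with g Finₚ.≟ w
    ... | no _       = *-identityʳ _
    ... | yes ≡.refl rewrite pending = *-identityˡ _

  ∑forwardᴱ*weightᴱ≤ :
    ∀ w E → ∑FlawSet (λ E′ → forwardᴱ w E E′ * weightᴱ E′) ≤ restWeight w E * ∏Γ w
  ∑forwardᴱ*weightᴱ≤ w E = begin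
    ∑FlawSet (λ E′ → forwardᴱ w E E′ * weightᴱ E′)
      ≈⟨ ∑product*product fwd wt ⟩
    product (λ g → sum λ b → fwd g b * wt g b)
      ≤⟨ product-mono-≤
           (λ g → sum-nonNegative λ b → *-nonNegative
             (forward-nonNegative (isAddressed w g) (isCaused w g) (lookup E g) b)
             (weight-nonNegative (μ≥0 g) b))
           (λ g → ∑forward*weight (isAddressed w g) (isCaused w g) (lookup E g) (μ≥0 g)) ⟩
    product (λ g → rest g * neighbour g)
      ≈⟨ product-distrib-* rest neighbour ⟩
    restWeight w E * product neighbour
      ≈⟨ *-congˡ (∏Γ≈product w) ⟨
    restWeight w E * ∏Γ w ∎
    where
    open ≤-Reasoning
    fwd wt : F → Fin 2 → ℝ
    fwd g = forward (isAddressed w g) (isCaused w g) (lookup E g)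
    wt g  = weight (value (μ g))
    rest neighbour : F → ℝ
    rest g      = if isAddressed w g then 1# else weight (value (μ g)) (lookup E g)
    neighbour g = if isCaused w g then 1# + value (μ g) else 1#

  -- The flaws other than `w` keep their weights, and the factor of `w` is replaced by `∏Γ w` over
  -- its amenability, which is at most `rate` times `μ w`.
  ∑bound*weightᴱ≤ :
    ∀ {w E} → Pending E w → ∑FlawSet (λ E′ → bound w E E′ * weightᴱ E′) ≤ rate * weightᴱ E
  ∑bound*weightᴱ≤ {w} {E} pending = begin
    ∑FlawSet (λ E′ → bound w E E′ * weightᴱ E′)
      ≈⟨ ∑Vec-cong (suc m) (λ E′ → *-assoc (1# / A⁺ w) (forwardᴱ w E E′) (weightᴱ E′)) ⟩
    ∑FlawSet (λ E′ → 1# / A⁺ w * (forwardᴱ w E E′ * weightᴱ E′))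
      ≈⟨ *-distribˡ-∑Vec (suc m) (1# / A⁺ w) (λ E′ → forwardᴱ w E E′ * weightᴱ E′) ⟨
    1# / A⁺ w * ∑FlawSet (λ E′ → forwardᴱ w E E′ * weightᴱ E′)
      ≤⟨ *-monoʳ-≤ (<⇒≤ (0</ (A⁺ w) 0<1)) (∑forwardᴱ*weightᴱ≤ w E) ⟩
    1# / A⁺ w * (restWeight w E * ∏Γ w)
      ≈⟨ x∙yz≈y∙xz (1# / A⁺ w) (restWeight w E) (∏Γ w) ⟩
    restWeight w E * (1# / A⁺ w * ∏Γ w)
      ≤⟨ *-monoʳ-≤ (restWeight-nonNegative w E) (∏Γ/A≤rate*μ w) ⟩
    restWeight w E * (rate * value (μ w))
      ≈⟨ x∙yz≈y∙xz (restWeight w E) rate (value (μ w)) ⟩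
    rate * (restWeight w E * value (μ w))
      ≈⟨ *-congˡ (restWeight*μ {w} {E} pending) ⟩
    rate * weightᴱ E ∎
    where
    open ≤-Reasoning

  -- Induction on the number of moves.

  ∑pending : ℕ → FlawSet → ℝ
  ∑pending T E = sum λ σ → pendingProbability T σ E

  -- The sum over starts is moved innermost, where `τ` is already fixed and atomicity applies.
  ∑pending-suc : ∀ T E → ∑pending (suc T) E ≈
                 sum λ τ → ∑FlawSet λ E′ → sum (λ σ → kernel σ τ E E′) * pendingProbability T τ E′
  ∑pending-suc T E = begin
    sum (λ σ → sum λ τ → ∑FlawSet λ E′ → kernel σ τ E E′ * C τ E′)
      ≈⟨ ∑-comm (λ σ τ → ∑FlawSet λ E′ → kernel σ τ E E′ * C τ E′) ⟩
    sum (λ τ → sum λ σ → ∑FlawSet λ E′ → kernel σ τ E E′ * C τ E′)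
      ≈⟨ sum-cong-≋ {x = λ τ → sum λ σ → ∑FlawSet λ E′ → kernel σ τ E E′ * C τ E′}
                    {y = λ τ → ∑FlawSet λ E′ → sum (λ σ → kernel σ τ E E′) * C τ E′} column ⟩
    sum (λ τ → ∑FlawSet λ E′ → sum (λ σ → kernel σ τ E E′) * C τ E′) ∎
    where
    open ≈-Reasoning
    C = pendingProbability T
    column : ∀ τ → sum (λ σ → ∑FlawSet λ E′ → kernel σ τ E E′ * C τ E′) ≈
                   ∑FlawSet λ E′ → sum (λ σ → kernel σ τ E E′) * C τ E′
    column τ = trans (sum-∑Vec-comm (suc m) (λ σ E′ → kernel σ τ E E′ * C τ E′))
      (∑Vec-cong (suc m) λ E′ → sym (*-distribʳ-sum (C τ E′) (λ σ → kernel σ τ E E′)))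

  total : ℕ → ℝ
  total T = fromℕ ∣Ω∣ * rate ^ T

  total-nonNegative : ∀ T → 0# ≤ total T
  total-nonNegative T = *-nonNegative (fromℕ-nonNegative ∣Ω∣) (^-nonNegative T rate≥0)

  ∑pending≤ : Atomic → ∀ T E → ∑pending T E ≤ total T * weightᴱ E
  ∑pending≤ atomic zero E = begin
    sum (λ (σ : Ω) → product (λ g → absent (lookup E g)))
      ≈⟨ sum-const ∣Ω∣ (product (λ g → absent (lookup E g))) ⟩
    fromℕ ∣Ω∣ * product (λ g → absent (lookup E g))
      -- With no move left only the empty set is possible, and its weight is 1.
      ≤⟨ *-monoʳ-≤ (fromℕ-nonNegative ∣Ω∣) (product-mono-≤
           (λ g → absent-nonNegative (lookup E g)) (λ g → absent≤weight (μ≥0 g) (lookup E g))) ⟩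
    fromℕ ∣Ω∣ * weightᴱ E
      ≈⟨ *-congʳ (*-identityʳ _) ⟨
    total zero * weightᴱ E ∎
    where open ≤-Reasoning
  ∑pending≤ atomic (suc T) E with empty-or-greatest π (pending? E)
  ... | inj₁ empty = ≤-trans
    (≤-reflexive (sum-zero {f = λ σ → pendingProbability (suc T) σ E} λ σ →
      sum-zero {f = λ τ → ∑FlawSet λ E′ → kernel σ τ E E′ * pendingProbability T τ E′} λ τ →
      ∑Vec-zero (suc m) λ E′ → trans (*-congʳ {x = pendingProbability T τ E′}
        (kernel-empty {E} empty σ τ E′)) (zeroˡ _)))
    (*-nonNegative (total-nonNegative (suc T)) (weightᴱ-nonNegative E))
  ... | inj₂ (w , w-greatest) = begin
    ∑pending (suc T) E
      ≈⟨ ∑pending-suc T E ⟩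
    sum (λ τ → ∑FlawSet λ E′ → sum (λ σ → kernel σ τ E E′) * C τ E′)
      ≤⟨ sum-mono-≤ {f = λ τ → ∑FlawSet λ E′ → sum (λ σ → kernel σ τ E E′) * C τ E′}
           {g = λ τ → ∑FlawSet λ E′ → bound w E E′ * C τ E′}
           (λ τ → ∑Vec-mono-≤ (suc m) λ E′ → *-monoˡ-≤ (pendingProbability-nonNegative T τ E′)
             (∑kernel≤bound atomic {E = E} w-greatest τ E′)) ⟩
    sum (λ τ → ∑FlawSet λ E′ → bound w E E′ * C τ E′)
      -- As `bound` does not involve `τ` either, summing over `τ` restores a sum over all starts, to
      -- which the induction hypothesis applies.
      ≈⟨ sum-∑Vec-comm (suc m) (λ τ E′ → bound w E E′ * C τ E′) ⟩
    ∑FlawSet (λ E′ → sum λ τ → bound w E E′ * C τ E′)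
      ≈⟨ ∑Vec-cong (suc m) (λ E′ → *-distribˡ-sum (bound w E E′) (λ τ → C τ E′)) ⟨
    ∑FlawSet (λ E′ → bound w E E′ * ∑pending T E′)
      ≤⟨ ∑Vec-mono-≤ (suc m) (λ E′ → *-monoʳ-≤ (bound-nonNegative w E E′) (∑pending≤ atomic T E′)) ⟩
    ∑FlawSet (λ E′ → bound w E E′ * (total T * weightᴱ E′))
      ≈⟨ ∑Vec-cong (suc m) (λ E′ → x∙yz≈y∙xz (bound w E E′) (total T) (weightᴱ E′)) ⟩
    ∑FlawSet (λ E′ → total T * (bound w E E′ * weightᴱ E′))
      ≈⟨ *-distribˡ-∑Vec (suc m) (total T) (λ E′ → bound w E E′ * weightᴱ E′) ⟨
    total T * ∑FlawSet (λ E′ → bound w E E′ * weightᴱ E′)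
      ≤⟨ *-monoʳ-≤ (total-nonNegative T) (∑bound*weightᴱ≤ {w} {E} (proj₁ w-greatest)) ⟩
    total T * (rate * weightᴱ E)
      ≈⟨ solve 4 (λ a b c d → (a ⊕ b) ⊕ (c ⊕ d) ⊜ (a ⊕ (c ⊕ b)) ⊕ d)
           refl (fromℕ ∣Ω∣) (rate ^ T) rate (weightᴱ E) ⟩
    total (suc T) * weightᴱ E ∎
    where
    open ≤-Reasoning
    open Algebra.Solver.CommutativeMonoid *-commutativeMonoid
    C = pendingProbability T

  avoids-sinks≤ :
    Atomic → ∀ T σ → avoids-sinks T σ ≤ total T * ∏ (U σ) (λ g → 1# + value (μ g))
  avoids-sinks≤ atomic T σ = begin
    avoids-sinks T σ
      ≈⟨ avoids-sinks≈∑pending T σ ⟩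
    ∑FlawSet (λ E → support σ E * pendingProbability T σ E)
      -- Dominating one start by the sum over all of them costs the factor `∣Ω∣`, the source of the
      -- first logarithm in `T₀`.
      ≤⟨ ∑Vec-mono-≤ (suc m) (λ E → *-monoʳ-≤ (support-nonNegative σ E)
           (≤-trans (term≤sum {f = λ σ → pendingProbability T σ E}
             (λ σ → pendingProbability-nonNegative T σ E) σ) (∑pending≤ atomic T E))) ⟩
    ∑FlawSet (λ E → support σ E * (total T * weightᴱ E))
      ≈⟨ ∑Vec-cong (suc m) (λ E → x∙yz≈y∙xz (support σ E) (total T) (weightᴱ E)) ⟩
    ∑FlawSet (λ E → total T * (support σ E * weightᴱ E))
      ≈⟨ *-distribˡ-∑Vec (suc m) (total T) (λ E → support σ E * weightᴱ E) ⟨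
    total T * ∑FlawSet (λ E → support σ E * weightᴱ E)
      -- `support` has kept the sum to subsets of `U σ`, so only flaws present at the start
      -- contribute a factor `1# + μ`.
      ≈⟨ *-congˡ (∑product*product (λ g → onlyIf (isPresent σ g)) (λ g → weight (value (μ g)))) ⟩
    total T * product (λ g → sum λ b → onlyIf (isPresent σ g) b * weight (value (μ g)) b)
      ≈⟨ *-congˡ (product-cong {y = λ g → if isPresent σ g then 1# + value (μ g) else 1#}
           λ g → ∑onlyIf*weight (isPresent σ g) (value (μ g))) ⟩
    total T * product (λ g → if isPresent σ g then 1# + value (μ g) else 1#)
      ≈⟨ *-congˡ (∏-filter-tabulate (λ g → present? g σ) (λ g → 1# + value (μ g)) id) ⟨
    total T * ∏ (U σ) (λ g → 1# + value (μ g)) ∎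
    where
    open ≤-Reasoning

-- From the bound to the number of steps.

module Conclusion {c ℓ₁ ℓ₂} (R : RealNumbers c ℓ₁ ℓ₂) {n m} (S : FlawSystem n m)
                  (μ : FlawSystem.F S → RealNumbers.ℝ⁺ R) where

  open RealProperties R
  open Exponential R
  open Sums R
  open FlawSystem S
  open ParameterProperties R S μ

  min⁺ : ℝ⁺
  min⁺ = fromℕ⁺ minAmenability minAmenability>0

  ratio : ℝ⁺
  ratio = max⁺ (λ f → μ f *⁺ A⁺ f) /⁺ min⁺

  -- Multiplying and dividing by the least amenability, then enlarging the numerator, yields one
  -- bound for all `μ`. Each flaw present at the start thus costs one logarithm of `1+⁺ ratio` in
  -- `T₀`.
  μ≤ratio : ∀ f → value (μ f) ≤ value ratio
  μ≤ratio f = begin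
    x                          ≈⟨ x/y*y≈x x min⁺ ⟨
    x * min⁻¹ * value min⁺     ≈⟨ xy∙z≈xz∙y x min⁻¹ (value min⁺) ⟩
    x * value min⁺ * min⁻¹
      ≤⟨ *-monoˡ-≤ (<⇒≤ min⁻¹>0) (*-monoʳ-≤ (μ≥0 f) (fromℕ-mono-≤ (minimum≤ amenability f))) ⟩
    x * value (A⁺ f) * min⁻¹
      ≤⟨ *-monoˡ-≤ (<⇒≤ min⁻¹>0) (t≤max (λ f → value (μ f) * value (A⁺ f)) f) ⟩
    value ratio                ∎
    where
    open ≤-Reasoning
    x = value (μ f)
    min⁻¹ = reciprocal (value min⁺) (proj₂ min⁺)
    min⁻¹>0 = reciprocal-positive (value min⁺) (proj₂ min⁺)

  ∣Ω∣*∏U≤2^T₀ : ∀ σ → fromℕ ∣Ω∣ * ∏ (U σ) (λ g → 1# + value (μ g)) ≤ 2^ (T₀ σ)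
  ∣Ω∣*∏U≤2^T₀ σ = begin
    fromℕ ∣Ω∣ * ∏ (U σ) (λ g → 1# + value (μ g))
      ≤⟨ *-monoʳ-≤ (fromℕ-nonNegative ∣Ω∣) (∏≤^length (U σ) (λ g → <⇒≤ (+-positive 0<1 (μ>0 g)))
           (λ g → +-monoʳ-≤ 1# (μ≤ratio g))) ⟩
    fromℕ ∣Ω∣ * value (1+⁺ ratio) ^ k
      ≈⟨ *-cong (2^log _ _) (^-congˡ k (2^log _ _)) ⟨
    2^ (log₂ Ω⁺) * (2^ (log₂ (1+⁺ ratio))) ^ k
      ≈⟨ *-congˡ (2^-homo-fromℕ* k (log₂ (1+⁺ ratio))) ⟨
    2^ (log₂ Ω⁺) * 2^ (fromℕ k * log₂ (1+⁺ ratio))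
      ≈⟨ 2^-homo-+ (log₂ Ω⁺) (fromℕ k * log₂ (1+⁺ ratio)) ⟨
    2^ (T₀ σ) ∎
    where
    open ≤-Reasoning
    k = List.length (U σ)
    Ω⁺ : ℝ⁺
    Ω⁺ = fromℕ⁺ ∣Ω∣ (s≤s z≤n)

  rate≤2^-δ : 0# < δ → rate ≤ 2^ (- δ)
  rate≤2^-δ δ>0 = begin
    rate                      ≈⟨ [x+y]-x≈y δ rate ⟨
    δ + rate - δ              ≈⟨ +-congʳ (trans (+-comm δ rate) (x+[y-x]≈y rate 1#)) ⟩
    1# - δ                    ≤⟨ 1-x≤2^-x δ>0 ⟩
    2^ (- δ)                  ∎
    where open ≤-Reasoning

  T₀-tδ<-s : (δ>0 : 0# < δ) → ∀ σ s t → (T₀ σ + s) / (δ , δ>0) < fromℕ t →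
    T₀ σ + fromℕ t * - δ < - s
  T₀-tδ<-s δ>0 σ s t enough = <-respˡ-≈ lhs (<-respʳ-≈ rhs (+-monoˡ-< (- s - tδ) T₀+s<tδ))
    where
    tδ = fromℕ t * δ
    T₀+s<tδ : T₀ σ + s < tδ
    T₀+s<tδ = <-respˡ-≈ (x/y*y≈x (T₀ σ + s) (δ , δ>0)) (*-monoˡ-< δ>0 enough)
    rhs : tδ + (- s - tδ) ≈ - s
    rhs = x+[y-x]≈y tδ (- s)
    lhs : T₀ σ + s + (- s - tδ) ≈ T₀ σ + fromℕ t * - δ
    lhs = begin
      T₀ σ + s + (- s - tδ)      ≈⟨ +-assoc (T₀ σ) s (- s - tδ) ⟩
      T₀ σ + (s + (- s - tδ))    ≈⟨ +-congˡ (+-assoc s (- s) (- tδ)) ⟨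
      T₀ σ + (s - s - tδ)
        ≈⟨ +-congˡ (trans (+-congʳ (-‿inverseʳ s)) (+-identityˡ (- tδ))) ⟩
      T₀ σ - tδ                  ≈⟨ +-congˡ (-‿distribʳ-* (fromℕ t) δ) ⟩
      T₀ σ + fromℕ t * - δ       ∎
      where open ≈-Reasoning

  module _ {_≼_ : Rel F 0ℓ} (π : IsTotalOrder _≡_ _≼_) where

    open WalkProperties R S π
    open PendingFlaws R S μ π

    avoids-sinks≤2^-s : Atomic → (δ>0 : 0# < δ) → ∀ σ s t → (T₀ σ + s) / (δ , δ>0) < fromℕ t →
                        avoids-sinks t σ ≤ 2^ (- s)
    avoids-sinks≤2^-s atomic δ>0 σ s t enough = begin
      avoids-sinks t σ                      ≤⟨ avoids-sinks≤ atomic t σ ⟩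
      fromℕ ∣Ω∣ * rate ^ t * ∏U             ≈⟨ xy∙z≈xz∙y (fromℕ ∣Ω∣) (rate ^ t) ∏U ⟩
      fromℕ ∣Ω∣ * ∏U * rate ^ t
        ≤⟨ *-monoˡ-≤ (^-nonNegative t rate≥0) (∣Ω∣*∏U≤2^T₀ σ) ⟩
      2^ (T₀ σ) * rate ^ t
        ≤⟨ *-monoʳ-≤ (<⇒≤ (2^-positive (T₀ σ))) (^-mono-≤ t rate≥0 (rate≤2^-δ δ>0)) ⟩
      2^ (T₀ σ) * (2^ (- δ)) ^ t            ≈⟨ *-congˡ (2^-homo-fromℕ* t (- δ)) ⟨
      2^ (T₀ σ) * 2^ (fromℕ t * - δ)        ≈⟨ 2^-homo-+ (T₀ σ) (fromℕ t * - δ) ⟨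
      2^ (T₀ σ + fromℕ t * - δ)             ≤⟨ <⇒≤ (2^-mono-< (T₀-tδ<-s δ>0 σ s t enough)) ⟩
      2^ (- s)                              ∎
      where
      open ≤-Reasoning
      ∏U = ∏ (U σ) (λ g → 1# + value (μ g))

    1-2^-s≤ℙ : Atomic → (δ>0 : 0# < δ) → ∀ σ s t → ⌊ (T₀ σ + s) / (δ , δ>0) ⌋≤ t →
               1# - 2^ (- s) ≤ ℙ[reaches-sink-from σ within t steps]
    1-2^-s≤ℙ atomic δ>0 σ s t enough = begin
      1# - 2^ (- s)                            ≈⟨ +-congʳ (ℙ+avoids-sinks≈1 t σ) ⟨
      P + avoids-sinks (suc t) σ - 2^ (- s)
        -- Missing the sinks within `t` steps means `t + 1` moves of the killed walk, which matches
        -- `⌊ x ⌋≤ t` being defined as `x < fromℕ (suc t)`.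
        ≤⟨ +-monoˡ-≤ (- 2^ (- s)) (+-monoʳ-≤ P (avoids-sinks≤2^-s atomic δ>0 σ s (suc t) enough)) ⟩
      P + 2^ (- s) - 2^ (- s)                  ≈⟨ +-congʳ (+-comm P (2^ (- s))) ⟩
      2^ (- s) + P - 2^ (- s)                  ≈⟨ [x+y]-x≈y (2^ (- s)) P ⟩
      P                                        ∎
      where
      open ≤-Reasoning
      P = ℙ[reaches-sink-from σ within t steps]

theorem2 : ∀ {c ℓ₁ ℓ₂ : Level} (R : RealNumbers c ℓ₁ ℓ₂) →
    let open RealNumbers R in
    {n m : ℕ} (S : FlawSystem n m) →
    let open FlawSystem S in
    Atomic →
    (μ : F → ℝ⁺) →
    let open Parameters R S μ in
    Condition →
    Σ[ δ>0 ∈ 0# < δ ]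
    ({_≼_ : Rel F 0ℓ} (π : IsTotalOrder _≡_ _≼_) →
    let open Walk R S π in
    (σ₁ : Ω) (s : ℝ) → 0# ≤ s →
    (t : ℕ) → ⌊ (T₀ σ₁ + s) / (δ , δ>0) ⌋≤ t →
    1# - 2^ (- s) ≤ ℙ[reaches-sink-from σ₁ within t steps])
theorem2 R S atomic μ condition =
  δ>0 , λ π σ₁ s _ t enough → 1-2^-s≤ℙ π atomic δ>0 σ₁ s t enough
  where
  open Conclusion R S μ
  δ>0 = ParameterProperties.Condition⇒δ>0 R S μ condition
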